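{- (1) The generating function for the number of up-down permutations of length $n$ that contain $1\mbox{ - }3\mbox{ - }2$ exactly once is $$\frac{x\bigl(1-\sqrt{1-4x^2}\bigr)}{1-4x^2+\sqrt{1-4x^2}};$$ equivalently, for every $n\ge0$ this number is $\binom{n-1}{(n-3)/2}$. (2) The generating function for the number of up-up permutations of length $n$ that contain $1\mbox{ - }3\mbox{ - }2$ exactly once is $$\frac{x^2-1}{x^2}+\frac{1-3x^2}{x^2\sqrt{1-4x^2}};$$ equivalently, for every $n\ge0$ this number is $2\binom{n-1}{(n-4)/2}$. (3) The generating function for the number of down-down permutations of length $n$ that contain $1\mbox{ - }3\mbox{ - }2$ exactly once is $$\frac{x^2-1}{x^2}+\frac{1-3x^2}{x^2\sqrt{1-4x^2}};$$ equivalently, for every $n\ge0$ this number is $2\binom{n-1}{(n-4)/2}$. (4) The generating function for the number of down-up permutations of length $n$ that contain $1\mbox{ - }3\mbox{ - }2$ exactly once is $$\frac{2x^4+4x^2-3}{2x^3}+\frac{3-10x^2}{2x^3\sqrt{1-4x^2}};$$ equivalently, for every $n\ge2$ this number is $\frac32\binom{n+3}{(n+3)/2}-5\binom{n+1}{(n+1)/2}$. Here $\binom ab$ is taken to be $0$ whenever $a<b$, $b<0$, or $b$ is not an integer.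
   Context: A permutation of length $n$ is a word $\pi_1\cdots\pi_n$ containing each of $1,\dots,n$ exactly once. An occurrence of the classical pattern $1\mbox{ - }3\mbox{ - }2$ in $\pi$ is a triple of indices $i<j<l$ with $\pi_i<\pi_l<\pi_j$; $\pi$ contains $1\mbox{ - }3\mbox{ - }2$ exactly once if there is exactly one such triple. For $n\ge2$: up-down permutations satisfy $\pi_1<\pi_2>\pi_3<\cdots$ with $n$ odd; up-up ones satisfy $\pi_1<\pi_2>\pi_3<\cdots$ with $n$ even; down-up ones satisfy $\pi_1>\pi_2<\pi_3>\cdots$ with $n$ odd; down-down ones satisfy $\pi_1>\pi_2<\pi_3>\cdots$ with $n$ even. For $n=0,1$ these classes are empty. Generating functions are $\sum_{n\ge0}c(n)x^n$ for the relevant count $c(n)$. -}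

module Defs where

open import Data.Nat using (ℕ; zero; suc; _+_; _*_; _∸_; _<ᵇ_; _≤ᵇ_)
open import Data.Nat.Combinatorics using (_C_)
open import Data.Integer using (ℤ; +_; -[1+_])
open import Data.Bool using (Bool; true; false; _∧_; if_then_else_)
open import Data.List using (List; []; _∷_; length; filter; map; concatMap; upTo)
open import Relation.Binary.PropositionalEquality using (_≡_)
open import Relation.Nullary.Decidable using (Dec)
open import Data.Bool using (T)
open import Relation.Nullary.Decidable using (T?)

words : ℕ → ℕ → List (List ℕ)
words m zero    = [] ∷ []
words m (suc k) = concatMap (λ w → map (λ a → suc a ∷ w) (upTo m)) (words m k)

countOcc : ℕ → List ℕ → ℕ
countOcc a []       = 0
countOcc a (x ∷ xs) = (if x ≡ᵇ′ a then 1 else 0) + countOcc a xs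
  where
  _≡ᵇ′_ : ℕ → ℕ → Bool
  x ≡ᵇ′ y = (x ≤ᵇ y) ∧ (y ≤ᵇ x)

allB : {A : Set} → (A → Bool) → List A → Bool
allB p []       = true
allB p (x ∷ xs) = p x ∧ allB p xs

isPermB : ℕ → List ℕ → Bool
isPermB n w = allB (λ i → (countOcc (suc i) w ≤ᵇ 1) ∧ (1 ≤ᵇ countOcc (suc i) w)) (upTo n)

perms : ℕ → List (List ℕ)
perms n = filter (λ w → T? (isPermB n w)) (words n n)

pairs132 : ℕ → List ℕ → ℕ
pairs132 x []       = 0
pairs132 x (y ∷ ys) = length (filter (λ z → T? ((x <ᵇ z) ∧ (z <ᵇ y))) ys) + pairs132 x ys

occ132 : List ℕ → ℕ
occ132 []       = 0
occ132 (x ∷ xs) = pairs132 x xs + occ132 xs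

mutual
  startsUp : List ℕ → Bool
  startsUp (a ∷ b ∷ r) = (a <ᵇ b) ∧ startsDown (b ∷ r)
  startsUp _           = true

  startsDown : List ℕ → Bool
  startsDown (a ∷ b ∷ r) = (b <ᵇ a) ∧ startsUp (b ∷ r)
  startsDown _           = true

oddB : ℕ → Bool
oddB zero          = false
oddB (suc zero)    = true
oddB (suc (suc n)) = oddB n

notB : Bool → Bool
notB true  = false
notB false = true

upDown upUp downUp downDown : ℕ → List ℕ → Bool
upDown   n w = (2 ≤ᵇ n) ∧ oddB n ∧ startsUp w
upUp     n w = (2 ≤ᵇ n) ∧ notB (oddB n) ∧ startsUp w
downUp   n w = (2 ≤ᵇ n) ∧ oddB n ∧ startsDown w
downDown n w = (2 ≤ᵇ n) ∧ notB (oddB n) ∧ startsDown w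

count132once : (ℕ → List ℕ → Bool) → ℕ → ℕ
count132once cls n =
  length (filter (λ w → T? (cls n w ∧ ((occ132 w ≤ᵇ 1) ∧ (1 ≤ᵇ occ132 w)))) (perms n))

-- Generalized binomial  binom a (t/2)  with a, t ∈ ℤ:
-- it is 0 whenever a < b, b < 0, or b = t/2 is not an integer.
halfBinom : ℤ → ℤ → ℕ
halfBinom a -[1+ _ ] = 0
halfBinom a (+ t) = if oddB t then 0 else go a
  where
  b : ℕ
  b = halfℕ t
    where
    halfℕ : ℕ → ℕ
    halfℕ zero = zero
    halfℕ (suc zero) = zero
    halfℕ (suc (suc k)) = suc (halfℕ k)
  go : ℤ → ℕ
  go -[1+ _ ] = 0
  go (+ m)    = m C b

{-# OPTIONS --safe #-}
-- Cut an alternating permutation w at its maximum m: w = w₁ m w₂, where w₂ starts with an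
-- ascent.  If w avoids 1-3-2, every entry of w₁ exceeds every entry of w₂.  If w contains 1-3-2
-- exactly once, either this still holds and the occurrence lies in w₁ or in w₂, or the
-- occurrence is a m c, where a is the last entry of w₁, c is the largest of w₂, a and c are
-- consecutive values, and w₁ without a and w₂ avoid 1-3-2.  With z = x², C = 1 + zC² and
-- B = 1/√(1 − 4z), the resulting convolution recurrences are solved by z B C² (up-down),
-- 2 z² B C³ (up-up, down-down) and 4 z² B C⁴ + z² C⁴ (down-up).  The series B Cᵏ has the
-- coefficients binom(2m + k, m), because both families satisfy G (k+1) = G k + z G (k+2).
module Submission where

open import Defs
open import Data.Bool using (Bool; T; _∧_; false; if_then_else_; true)
open import Data.Bool.Properties using (T-∧)
open import Data.Empty using (⊥)
open import Data.List using (List; []; [_]; _++_; _∷_; cartesianProduct; filter; length; map; upTo)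
open import Data.List.Membership.Propositional using (_∈_; _∉_; find)
open import Data.List.Membership.Propositional.Properties using (∈-++⁺ʳ; ∈-++⁺ˡ; ∈-++⁻; ∈-cartesianProduct⁺; ∈-cartesianProduct⁻; ∈-concatMap⁺; ∈-concatMap⁻; ∈-filter⁺; ∈-filter⁻; ∈-map⁺; ∈-map⁻; ∈-upTo⁺; ∈-upTo⁻; ∈-∃++)
open import Data.List.Membership.Propositional.Properties.WithK using (unique∧set⇒bag)
open import Data.List.Properties using (++-assoc; filter-++; filter-accept; filter-reject; length-++; length-map; ∷-injective; ∷-injectiveʳ; ∷-injectiveˡ; ∷ʳ-injective)
open import Data.List.Relation.Binary.BagAndSetEquality using (∼bag⇒↭)
open import Data.List.Relation.Binary.Permutation.Propositional using (_↭_; prep; swap; ↭-refl; ↭-reflexive; ↭-sym; ↭-trans; ↭⇒↭ₛ) renaming (refl to ↭-rfl; trans to ↭-tr)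
open import Data.List.Relation.Binary.Permutation.Propositional.Properties using (All-resp-↭; drop-mid; filter-↭; ¬x∷xs↭[]; ↭-empty-inv; ↭-length; ↭-singleton-inv; ∈-resp-↭) renaming (++⁺ to ↭-++⁺; shift to ↭-shift)
open import Data.List.Relation.Binary.Permutation.Setoid.Properties using (Unique-resp-↭)
open import Data.List.Relation.Unary.All as All using (All; []; _∷_)
import Data.List.Relation.Unary.All.Properties as All
open import Data.List.Relation.Unary.AllPairs as AllPairs using (AllPairs; []; _∷_)
import Data.List.Relation.Unary.AllPairs.Properties as AllPairs
open import Data.List.Relation.Unary.Any as Any using (here; there)
open import Data.List.Relation.Unary.Unique.Propositional using (Unique)
import Data.List.Relation.Unary.Unique.Propositional.Properties as Unique
open import Data.Nat
open import Data.Nat.Combinatorics using (_C_; nCk+nC[k+1]≡[n+1]C[k+1]; nCk≡nC[n∸k]; nCn≡1)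
open import Data.Nat.Properties
open import Data.Nat.Solver using (module +-*-Solver)
open import Data.Product using (_,_; _×_; proj₁; proj₂; ∃; ∃₂)
open import Data.Sum using (_⊎_; inj₁; inj₂)
open import Data.Unit using (tt; ⊤)
open import Function using (_∋_; _∘_)
open import Function.Bundles using (Equivalence; mk⇔)
open import Relation.Binary.PropositionalEquality using (_≗_; _≡_; _≢_; cong; cong₂; module ≡-Reasoning; refl; setoid; subst; subst₂; sym; trans)
open import Relation.Nullary using (contradiction; no; yes; ¬_)
open import Relation.Nullary.Decidable using (T?)

open ≡-Reasoning

-- Square roots and quotients of series are avoided altogether. Since C = 1 + zC², the family G k =
-- H Cᵏ satisfies G (k+1) = G k + z G (k+2) for every series H, and a family with this recurrence is
-- determined by G 0. An identity between two such families is therefore only checked at exponent 0.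
-- For B this reduces everything to Pascal's rule and the symmetry of binomial coefficients, which
-- yield B Cᵏ = Cᵏ + 2 z B Cᵏ⁺¹, the relation behind all the recurrences for words with one
-- occurrence. The variable z = x² enters because the maximum of an alternating word with at least
-- two letters stands at a peak: the direction of the word fixes the parity of the length of the
-- left part. Each counting series in x is therefore kept as a pair of series in z, one for each
-- parity, and every convolution uses only one half of its left factor.

interchange : ∀ a b c d → (a + b) + (c + d) ≡ (a + c) + (b + d)
interchange = solve 4 (λ a b c d → (a :+ b) :+ (c :+ d) := (a :+ c) :+ (b :+ d)) refl
  where open +-*-Solver

-- Power series with natural coefficients

Series : Set
Series = ℕ → ℕ

𝟎 : Series
𝟎 _ = 0

_⊕_ : Series → Series → Series
(f ⊕ g) n = f n + g n

tail : Series → Series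
tail f n = f (suc n)

z· : Series → Series
z· f zero    = 0
z· f (suc n) = f n

infixl 7 _⊛_
infixl 6 _⊕_

-- The Cauchy product, peeled from the lowest coefficient of the left factor; `card-glue` follows
-- the same recursion along the cuts of a list.
_⊛_ : Series → Series → Series
(f ⊛ g) zero    = f 0 * g 0
(f ⊛ g) (suc n) = f 0 * g (suc n) + (tail f ⊛ g) n

z·-cong : ∀ {f g} → f ≗ g → z· f ≗ z· g
z·-cong p zero    = refl
z·-cong p (suc n) = p n

z·-⊕ : ∀ f g → z· (f ⊕ g) ≗ z· f ⊕ z· g
z·-⊕ f g zero    = refl
z·-⊕ f g (suc n) = refl

⊛-cong : ∀ {f f′ g g′} → f ≗ f′ → g ≗ g′ → f ⊛ g ≗ f′ ⊛ g′
⊛-cong p q zero    = cong₂ _*_ (p 0) (q 0)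
⊛-cong p q (suc n) = cong₂ _+_ (cong₂ _*_ (p 0) (q (suc n))) (⊛-cong (p ∘ suc) q n)

⊛-distribˡ-⊕ : ∀ f g h → f ⊛ (g ⊕ h) ≗ f ⊛ g ⊕ f ⊛ h
⊛-distribˡ-⊕ f g h zero    = *-distribˡ-+ (f 0) (g 0) (h 0)
⊛-distribˡ-⊕ f g h (suc n) = begin
  f 0 * (g (suc n) + h (suc n)) + (tail f ⊛ (g ⊕ h)) n
    ≡⟨ cong₂ _+_ (*-distribˡ-+ (f 0) _ _) (⊛-distribˡ-⊕ (tail f) g h n) ⟩
  (f 0 * g (suc n) + f 0 * h (suc n)) + ((tail f ⊛ g) n + (tail f ⊛ h) n)
    ≡⟨ interchange (f 0 * g (suc n)) _ _ _ ⟩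
  (f ⊛ g ⊕ f ⊛ h) (suc n) ∎

-- The definition peels the left factor. Peeling the right one too turns commutativity into an
-- induction.
⊛-sucʳ : ∀ f g n → (f ⊛ g) (suc n) ≡ g 0 * f (suc n) + (f ⊛ tail g) n
⊛-sucʳ f g zero    = begin
  f 0 * g 1 + f 1 * g 0 ≡⟨ +-comm (f 0 * g 1) _ ⟩
  f 1 * g 0 + f 0 * g 1 ≡⟨ cong (_+ f 0 * g 1) (*-comm (f 1) (g 0)) ⟩
  g 0 * f 1 + f 0 * g 1 ∎
⊛-sucʳ f g (suc n) = begin
  f 0 * g (2 + n) + (tail f ⊛ g) (suc n)
    ≡⟨ cong (f 0 * g (2 + n) +_) (⊛-sucʳ (tail f) g n) ⟩
  f 0 * g (2 + n) + (g 0 * f (2 + n) + (tail f ⊛ tail g) n)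
    ≡⟨ +-assoc (f 0 * g (2 + n)) _ _ ⟨
  f 0 * g (2 + n) + g 0 * f (2 + n) + (tail f ⊛ tail g) n
    ≡⟨ cong (_+ (tail f ⊛ tail g) n) (+-comm (f 0 * g (2 + n)) _) ⟩
  g 0 * f (2 + n) + f 0 * g (2 + n) + (tail f ⊛ tail g) n
    ≡⟨ +-assoc (g 0 * f (2 + n)) _ _ ⟩
  g 0 * f (2 + n) + (f ⊛ tail g) (suc n) ∎

⊛-comm : ∀ f g → f ⊛ g ≗ g ⊛ f
⊛-comm f g zero    = *-comm (f 0) (g 0)
⊛-comm f g (suc n) =
  trans (⊛-sucʳ f g n) (cong (g 0 * f (suc n) +_) (⊛-comm f (tail g) n))

⊛-z·ˡ : ∀ f g → z· f ⊛ g ≗ z· (f ⊛ g)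
⊛-z·ˡ f g zero    = refl
⊛-z·ˡ f g (suc n) = refl

⊛-z·ʳ : ∀ f g → f ⊛ z· g ≗ z· (f ⊛ g)
⊛-z·ʳ f g n = begin
  (f ⊛ z· g) n   ≡⟨ ⊛-comm f (z· g) n ⟩
  (z· g ⊛ f) n   ≡⟨ ⊛-z·ˡ g f n ⟩
  z· (g ⊛ f) n   ≡⟨ z·-cong (⊛-comm g f) n ⟩
  z· (f ⊛ g) n   ∎

-- The even-indexed coefficients of the result are f, the odd-indexed ones g.
interleave : Series → Series → Series
interleave f g zero    = f 0
interleave f g (suc n) = interleave g (tail f) n

interleave-cong : ∀ {f f′ g g′} → f ≗ f′ → g ≗ g′ → interleave f g ≗ interleave f′ g′
interleave-cong p q zero    = p 0
interleave-cong p q (suc n) = interleave-cong q (p ∘ suc) n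

interleave-⊕ : ∀ f g f′ g′ →
  interleave (f ⊕ f′) (g ⊕ g′) ≗ interleave f g ⊕ interleave f′ g′
interleave-⊕ f g f′ g′ zero    = refl
interleave-⊕ f g f′ g′ (suc n) = interleave-⊕ g (tail f) g′ (tail f′) n

interleave-scale : ∀ c f g n → c * interleave f g n ≡ interleave (λ k → c * f k) (λ k → c * g k) n
interleave-scale c f g zero    = refl
interleave-scale c f g (suc n) = interleave-scale c g (tail f) n

⊛-unfold : ∀ f g → f ⊛ g ≗ (λ n → f 0 * g n) ⊕ z· (tail f ⊛ g)
⊛-unfold f g zero    = sym (+-identityʳ _)
⊛-unfold f g (suc n) = refl

mutual
  -- `interleave a b` stands for a(x²) + x b(x²). An even left factor preserves the two halves; an
  -- odd one exchanges them, and x · x = z accounts for the `z·` in `odds-⊛`.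
  evens-⊛ : ∀ f a b → interleave f 𝟎 ⊛ interleave a b ≗ interleave (f ⊛ a) (f ⊛ b)
  evens-⊛ f a b zero    = refl
  evens-⊛ f a b (suc n) = begin
    f 0 * interleave b (tail a) n + (interleave 𝟎 (tail f) ⊛ interleave a b) n
      ≡⟨ cong₂ _+_ (interleave-scale (f 0) b (tail a) n) (odds-⊛ (tail f) a b n) ⟩
    interleave (λ k → f 0 * b k) (λ k → f 0 * a (suc k)) n
      + interleave (z· (tail f ⊛ b)) (tail f ⊛ a) n
      ≡⟨ interleave-⊕ _ _ (z· (tail f ⊛ b)) (tail f ⊛ a) n ⟨
    interleave ((λ k → f 0 * b k) ⊕ z· (tail f ⊛ b)) (tail (f ⊛ a)) n
      ≡⟨ interleave-cong (sym ∘ ⊛-unfold f b) (λ _ → refl) n ⟩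
    interleave (f ⊛ b) (tail (f ⊛ a)) n ∎

  odds-⊛ : ∀ g a b → interleave 𝟎 g ⊛ interleave a b ≗ interleave (z· (g ⊛ b)) (g ⊛ a)
  odds-⊛ g a b zero    = refl
  odds-⊛ g a b (suc n) = evens-⊛ g a b n

-- Powers of the Catalan series and binomial coefficients

-- The recurrence satisfied by G k = H · Cᵏ, where C = 1 + z C² is the Catalan series.
Ladder : (ℕ → Series) → Set
Ladder G = ∀ k → G (suc k) ≗ G k ⊕ z· (G (2 + k))

-- The recurrence refers to the previous index in the same degree, or to a higher index in a smaller
-- degree. Lexicographic induction on degree and index therefore terminates.
ladder-unique : ∀ {G H} → Ladder G → Ladder H → G 0 ≗ H 0 → ∀ k → G k ≗ H k
ladder-unique {G} {H} lg lh base = go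
  where
  go : ∀ k n → G k n ≡ H k n
  go zero    n       = base n
  go (suc k) zero    = begin
    G (suc k) 0   ≡⟨ lg k 0 ⟩
    G k 0 + 0     ≡⟨ cong (_+ 0) (go k 0) ⟩
    H k 0 + 0     ≡⟨ lh k 0 ⟨
    H (suc k) 0   ∎
  go (suc k) (suc n) = begin
    G (suc k) (suc n)            ≡⟨ lg k (suc n) ⟩
    G k (suc n) + G (2 + k) n    ≡⟨ cong₂ _+_ (go k (suc n)) (go (2 + k) n) ⟩
    H k (suc n) + H (2 + k) n    ≡⟨ lh k (suc n) ⟨
    H (suc k) (suc n)            ∎

-- catalanPower k m is the coefficient of zᵐ in Cᵏ.
catalanPower : ℕ → Series
catalanPower zero    zero    = 1
catalanPower zero    (suc m) = 0
catalanPower (suc k) zero    = catalanPower k zero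
catalanPower (suc k) (suc m) = catalanPower k (suc m) + catalanPower (2 + k) m

catalanPower-ladder : Ladder catalanPower
catalanPower-ladder k zero    = sym (+-identityʳ _)
catalanPower-ladder k (suc m) = refl

⊛-identityʳ : ∀ f → f ⊛ catalanPower 0 ≗ f
⊛-identityʳ f zero    = *-identityʳ (f 0)
⊛-identityʳ f (suc n) = cong₂ _+_ (*-zeroʳ (f 0)) (⊛-identityʳ (tail f) n)

-- For fixed `k` both sides are ladders in `l`, and at `l = 0` the factor is the unit series. This
-- replaces the law of exponents for powers of C.
ladder-⊛ : ∀ {G} → Ladder G → ∀ k l → G k ⊛ catalanPower l ≗ G (l + k)
ladder-⊛ {G} lg k =
  ladder-unique {λ l → G k ⊛ catalanPower l} {λ l → G (l + k)}
    (λ l n → begin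
      (G k ⊛ catalanPower (suc l)) n
        ≡⟨ ⊛-cong {G k} (λ _ → refl) (catalanPower-ladder l) n ⟩
      (G k ⊛ (catalanPower l ⊕ z· (catalanPower (2 + l)))) n
        ≡⟨ ⊛-distribˡ-⊕ (G k) (catalanPower l) _ n ⟩
      (G k ⊛ catalanPower l) n + (G k ⊛ z· (catalanPower (2 + l))) n
        ≡⟨ cong ((G k ⊛ catalanPower l) n +_) (⊛-z·ʳ (G k) _ n) ⟩
      (G k ⊛ catalanPower l) n + z· (G k ⊛ catalanPower (2 + l)) n ∎)
    (λ l → lg (l + k))
    (⊛-identityʳ (G k))

-- The coefficient of zᵐ in Cᵏ / √(1 − 4z).
binomialLadder : ℕ → Series
binomialLadder k m = (k + (m + m)) C m

nC0≡1 : ∀ n → n C 0 ≡ 1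
nC0≡1 n = trans (nCk≡nC[n∸k] {0} {n} z≤n) (nCn≡1 n)

-- This is Pascal's rule, because k + 2(m+1) = (k+2) + 2m.
binomialLadder-ladder : Ladder binomialLadder
binomialLadder-ladder k zero    = begin
  suc (k + 0) C 0     ≡⟨ nC0≡1 (suc (k + 0)) ⟩
  1                   ≡⟨ nC0≡1 (k + 0) ⟨
  (k + 0) C 0         ≡⟨ +-identityʳ _ ⟨
  (k + 0) C 0 + 0     ∎
binomialLadder-ladder k (suc m) = begin
  suc (k + (suc m + suc m)) C suc m
    ≡⟨ nCk+nC[k+1]≡[n+1]C[k+1] (k + (suc m + suc m)) m ⟨
  (k + (suc m + suc m)) C m + (k + (suc m + suc m)) C suc m
    ≡⟨ +-comm ((k + (suc m + suc m)) C m) _ ⟩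
  (k + (suc m + suc m)) C suc m + (k + (suc m + suc m)) C m
    ≡⟨ cong (λ t → (k + (suc m + suc m)) C suc m + t C m) (reindex k m) ⟩
  (k + (suc m + suc m)) C suc m + (2 + k + (m + m)) C m ∎
  where
  open +-*-Solver
  reindex : ∀ k m → k + (suc m + suc m) ≡ 2 + k + (m + m)
  reindex = solve 2 (λ k m → k :+ ((con 1 :+ m) :+ (con 1 :+ m)) := con 2 :+ k :+ (m :+ m)) refl

double : Series → Series
double f n = 2 * f n

z·-double : ∀ f → double (z· f) ≗ z· (double f)
z·-double f zero    = refl
z·-double f (suc n) = refl

-- The identity B = 1 + 2zBC: Pascal's rule splits a central binomial coefficient into two
-- neighbours that are equal by symmetry.
binomialLadder-base : binomialLadder 0 ≗ catalanPower 0 ⊕ z· (double (binomialLadder 1))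
binomialLadder-base zero    = refl
binomialLadder-base (suc m) = begin
  (suc m + suc m) C suc m
    ≡⟨ nCk+nC[k+1]≡[n+1]C[k+1] (m + suc m) m ⟨
  (m + suc m) C m + (m + suc m) C suc m
    ≡⟨ cong ((m + suc m) C m +_) (nCk≡nC[n∸k] (m≤n+m (suc m) m)) ⟩
  (m + suc m) C m + (m + suc m) C (m + suc m ∸ suc m)
    ≡⟨ cong (λ t → (m + suc m) C m + (m + suc m) C t) (m+n∸n≡m m (suc m)) ⟩
  (m + suc m) C m + (m + suc m) C m
    ≡⟨ cong (λ t → (m + suc m) C m + t) (+-identityʳ _) ⟨
  2 * ((m + suc m) C m)
    ≡⟨ cong (λ t → 2 * (t C m)) (+-suc m m) ⟩
  2 * (suc (m + m) C m) ∎

-- Both sides are ladders in `k`, so `binomialLadder-base` multiplied by Cᵏ needs no separate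
-- computation.
ladder-unfold : ∀ k →
  binomialLadder k ≗ catalanPower k ⊕ z· (double (binomialLadder (suc k)))
ladder-unfold = ladder-unique {binomialLadder}
  {λ k → catalanPower k ⊕ z· (double (binomialLadder (suc k)))}
  binomialLadder-ladder
  (λ k n → begin
    catalanPower (suc k) n + z· (double (binomialLadder (2 + k))) n
      ≡⟨ cong₂ _+_ (catalanPower-ladder k n)
           (z·-cong (λ m → trans (cong (2 *_) (binomialLadder-ladder (suc k) m))
                                 (*-distribˡ-+ 2 (binomialLadder (suc k) m) _)) n) ⟩
    catalanPower k n + z· (catalanPower (2 + k)) n
      + z· (double (binomialLadder (suc k)) ⊕ double (z· (binomialLadder (3 + k)))) n
      ≡⟨ regroup k n ⟩
    catalanPower k n + z· (double (binomialLadder (suc k))) n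
      + z· (catalanPower (2 + k) ⊕ z· (double (binomialLadder (3 + k)))) n ∎)
  binomialLadder-base
  where
  regroup : ∀ k n →
    catalanPower k n + z· (catalanPower (2 + k)) n
      + z· (double (binomialLadder (suc k)) ⊕ double (z· (binomialLadder (3 + k)))) n
    ≡ catalanPower k n + z· (double (binomialLadder (suc k))) n
      + z· (catalanPower (2 + k) ⊕ z· (double (binomialLadder (3 + k)))) n
  regroup k zero          = refl
  regroup k (suc zero)    = interchange (catalanPower k 1) _ _ _
  regroup k (suc (suc n)) = interchange (catalanPower k (2 + n)) _ _ _

-- With s = √(1 − 4z) one has C = 2/(1 + s), hence C + C/s = 2/s.
catalanPower+binomialLadder : ∀ k →
  catalanPower (suc k) ⊕ binomialLadder (suc k) ≗ double (binomialLadder k)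
catalanPower+binomialLadder k n = +-cancelʳ-≡ (binomialLadder (suc k) n) _ _ (begin
  (t + b₁) + b₁          ≡⟨ cong (λ x → (t + x) + x) (binomialLadder-ladder k n) ⟩
  (t + (b₀ + s)) + (b₀ + s)
    ≡⟨ solve 3 (λ t b s → (t :+ (b :+ s)) :+ (b :+ s) := con 2 :* b :+ (t :+ con 2 :* s)) refl t b₀ s ⟩
  2 * b₀ + (t + 2 * s)   ≡⟨ cong (λ x → 2 * b₀ + (t + x)) (z·-double (binomialLadder (2 + k)) n) ⟩
  2 * b₀ + (t + z· (double (binomialLadder (2 + k))) n)
                         ≡⟨ cong (2 * b₀ +_) (ladder-unfold (suc k) n) ⟨
  2 * b₀ + b₁            ∎)
  where
  open +-*-Solver
  t = catalanPower (suc k) n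
  b₀ = binomialLadder k n
  b₁ = binomialLadder (suc k) n
  s = z· (binomialLadder (2 + k)) n

-- Finite cardinalities

-- Elements are counted, not proofs: `P` may hold of an element in several ways, which lets
-- existential witnesses such as cuts of a list occur inside `P`.
record Card {A : Set} (P : A → Set) (c : ℕ) : Set where
  field
    elems    : List A
    unique   : Unique elems
    sound    : ∀ {x} → x ∈ elems → P x
    complete : ∀ {x} → P x → x ∈ elems
    size     : length elems ≡ c

open Card

module _ {A : Set} {P : A → Set} where

  card-unique : ∀ {a b} → Card P a → Card P b → a ≡ b
  card-unique p q = trans (sym (size p)) (trans
    (↭-length (∼bag⇒↭ (unique∧set⇒bag (unique p) (unique q)
      (mk⇔ (λ i → complete q (sound p i)) (λ i → complete p (sound q i))))))
    (size q))

  card-⇔ : ∀ {Q : A → Set} {c} → (∀ {x} → P x → Q x) → (∀ {x} → Q x → P x) → Card P c → Card Q c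
  card-⇔ to from p = record
    { elems = elems p ; unique = unique p ; size = size p
    ; sound = λ i → to (sound p i) ; complete = λ q → complete p (from q) }

  card-∅ : (∀ {x} → ¬ P x) → Card P 0
  card-∅ absent = record
    { elems = [] ; unique = [] ; size = refl ; sound = λ () ; complete = λ p → contradiction p absent }

  card-singleton : ∀ {y} → P y → (∀ {x} → P x → x ≡ y) → Card P 1
  card-singleton {y} py only = record
    { elems = y ∷ [] ; unique = [] ∷ [] ; size = refl
    ; sound = λ { (here refl) → py } ; complete = λ p → here (only p) }

  card-⊎ : ∀ {Q : A → Set} {a b} → (∀ {x} → P x → Q x → ⊥) →
           Card P a → Card Q b → Card (λ x → P x ⊎ Q x) (a + b)
  card-⊎ disj p q = record
    { elems = elems p ++ elems q
    ; unique = Unique.++⁺ (unique p) (unique q) (λ { (i , j) → disj (sound p i) (sound q j) })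
    ; size = trans (length-++ (elems p)) (cong₂ _+_ (size p) (size q))
    ; sound = λ i → snd (∈-++⁻ (elems p) i)
    ; complete = λ { (inj₁ x) → ∈-++⁺ˡ (complete p x) ; (inj₂ y) → ∈-++⁺ʳ (elems p) (complete q y) } }
    where
    snd : ∀ {x} → x ∈ elems p ⊎ x ∈ elems q → P x ⊎ _
    snd (inj₁ i) = inj₁ (sound p i)
    snd (inj₂ j) = inj₂ (sound q j)

length-cartesianProduct : {A B : Set} (xs : List A) (ys : List B) →
  length (cartesianProduct xs ys) ≡ length xs * length ys
length-cartesianProduct []       ys = refl
length-cartesianProduct (x ∷ xs) ys = trans (length-++ (map (x ,_) ys))
  (cong₂ _+_ (length-map (x ,_) ys) (length-cartesianProduct xs ys))

unique-map : {A B : Set} (f : A → B) {xs : List A} →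
  (∀ {x y} → x ∈ xs → y ∈ xs → f x ≡ f y → x ≡ y) → Unique xs → Unique (map f xs)
unique-map f inj []       = []
unique-map f inj (x∉ ∷ u) =
  All.tabulate (λ j eq → let y , y∈ , fy = ∈-map⁻ f j in
    All.lookup x∉ y∈ (inj (here refl) (there y∈) (trans eq fy)))
  ∷ unique-map f (λ i j → inj (there i) (there j)) u

card-map : {A B : Set} {P : A → Set} {c : ℕ} (f : A → B) → (∀ {x y} → f x ≡ f y → x ≡ y) →
  Card P c → Card (λ y → ∃ λ x → y ≡ f x × P x) c
card-map f inj p = record
  { elems    = map f (elems p)
  ; unique   = Unique.map⁺ inj (unique p)
  ; size     = trans (length-map f (elems p)) (size p)
  ; sound    = λ i → let x , x∈ , eq = ∈-map⁻ f i in x , eq , sound p x∈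
  ; complete = λ { (x , refl , px) → ∈-map⁺ f (complete p px) } }

card-× : {A B D : Set} {P : A → Set} {Q : B → Set} {a b : ℕ} (f : A → B → D) →
  (∀ {x y x′ y′} → P x → Q y → P x′ → Q y′ → f x y ≡ f x′ y′ → x ≡ x′ × y ≡ y′) →
  Card P a → Card Q b → Card (λ w → ∃₂ λ x y → P x × Q y × w ≡ f x y) (a * b)
card-× {P = P} {Q} f inj p q = record
  { elems    = map (λ (x , y) → f x y) (cartesianProduct (elems p) (elems q))
  ; unique   = unique-map _ inj′ (Unique.cartesianProduct⁺ (unique p) (unique q))
  ; size     = trans (length-map _ (cartesianProduct (elems p) (elems q)))
                 (trans (length-cartesianProduct (elems p) (elems q)) (cong₂ _*_ (size p) (size q)))
  ; sound    = λ i → let (x , y) , xy∈ , eq = ∈-map⁻ _ i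
                         px , qy = members xy∈ in x , y , px , qy , eq
  ; complete = λ { (x , y , px , qy , refl) →
                   ∈-map⁺ _ (∈-cartesianProduct⁺ (complete p px) (complete q qy)) } }
  where
  members : ∀ {x y} → (x , y) ∈ cartesianProduct (elems p) (elems q) → P x × Q y
  members i = let x∈ , y∈ = ∈-cartesianProduct⁻ (elems p) (elems q) i in sound p x∈ , sound q y∈
  inj′ : ∀ {xy xy′} → xy ∈ cartesianProduct (elems p) (elems q) →
         xy′ ∈ cartesianProduct (elems p) (elems q) →
         f (proj₁ xy) (proj₂ xy) ≡ f (proj₁ xy′) (proj₂ xy′) → xy ≡ xy′
  inj′ i j eq with members i | members j
  ... | px , qy | px′ , qy′ with inj px qy px′ qy′ eq
  ... | refl , refl = refl

module _ {I A : Set} where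

  -- The cut of `V` distributes the letters over the two factors; the predicates depend on the
  -- letters and not only on their number.
  Glue : (P Q : List I → List A → Set) → List I → List A → Set
  Glue P Q V w = ∃₂ λ V₁ V₂ → V ≡ V₁ ++ V₂ × ∃₂ λ w₁ w₂ → P V₁ w₁ × Q V₂ w₂ × w ≡ w₁ ++ w₂

  -- Equality of the cuts makes the families for different cuts disjoint; equality of the factors
  -- makes each single family a product.
  UniqueGlue : (P Q : List I → List A → Set) → List I → Set
  UniqueGlue P Q V = ∀ {V₁ V₂ V₁′ V₂′ w₁ w₂ w₁′ w₂′} →
    V ≡ V₁ ++ V₂ → V ≡ V₁′ ++ V₂′ → P V₁ w₁ → Q V₂ w₂ → P V₁′ w₁′ → Q V₂′ w₂′ →
    w₁ ++ w₂ ≡ w₁′ ++ w₂′ → V₁ ≡ V₁′ × w₁ ≡ w₁′ × w₂ ≡ w₂′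

  -- Either the cut is at the front, which contributes f 0 times the last coefficient of `g`, or `v`
  -- goes to the left and `P` and `f` are shifted by one.
  card-glue : ∀ {P Q} V (f g : Series) →
    (∀ V₁ V₂ → V ≡ V₁ ++ V₂ → Card (P V₁) (f (length V₁))) →
    (∀ V₁ V₂ → V ≡ V₁ ++ V₂ → Card (Q V₂) (g (length V₂))) →
    UniqueGlue P Q V → Card (Glue P Q V) ((f ⊛ g) (length V))
  card-glue [] f g cp cq inj =
    card-⇔ (λ { (w₁ , w₂ , p , q , e) → [] , [] , refl , w₁ , w₂ , p , q , e })
           (λ { ([] , [] , refl , r) → r })
      (card-× _++_ (λ p q p′ q′ e → proj₂ (inj refl refl p q p′ q′ e))
        (cp [] [] refl) (cq [] [] refl))
  card-glue {P} {Q} (v ∷ V) f g cp cq inj =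
    card-⇔ (λ { (inj₁ (w₁ , w₂ , r)) → [] , v ∷ V , refl , w₁ , w₂ , r
              ; (inj₂ (V₁ , V₂ , refl , r)) → v ∷ V₁ , V₂ , refl , r })
           (λ { ([] , _ , refl , r) → inj₁ r
              ; (_ ∷ V₁ , V₂ , refl , r) → inj₂ (V₁ , V₂ , refl , r) })
      (card-⊎ (λ { (_ , _ , p , q , refl) (_ , _ , refl , _ , _ , p′ , q′ , e′) →
                   []≢∷ (proj₁ (inj refl refl p q p′ q′ e′)) })
        (card-× _++_ (λ p q p′ q′ e → proj₂ (inj refl refl p q p′ q′ e))
          (cp [] (v ∷ V) refl) (cq [] (v ∷ V) refl))
        (card-glue {λ V₁ → P (v ∷ V₁)} {Q} V (tail f) g
          (λ V₁ V₂ e → cp (v ∷ V₁) V₂ (cong (v ∷_) e))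
          (λ V₁ V₂ e → cq (v ∷ V₁) V₂ (cong (v ∷_) e))
          (λ e e′ p q p′ q′ eq →
            let a , b = inj (cong (v ∷_) e) (cong (v ∷_) e′) p q p′ q′ eq
            in proj₂ (∷-injective a) , b)))
    where
    []≢∷ : ∀ {V₁ : List I} → (List I ∋ []) ≡ v ∷ V₁ → ⊥
    []≢∷ ()

-- Alternating words

data Direction : Set where
  up down : Direction

flip : Direction → Direction
flip up   = down
flip down = up

Step : Direction → ℕ → ℕ → Set
Step up   a b = a < b
Step down a b = b < a

Alternating : Direction → List ℕ → Set
Alternating d (a ∷ b ∷ r) = Step d a b × Alternating (flip d) (b ∷ r)
Alternating d _           = ⊤

-- Position i (counted from 0) is a peak of alternating words that start in direction d.
Peak : Direction → ℕ → Set
Peak d    (suc i) = Peak (flip d) i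
Peak up   zero    = ⊥
Peak down zero    = ⊤

alternating-tail : ∀ d m w → Alternating d (m ∷ w) → Alternating (flip d) w
alternating-tail d m []      _       = tt
alternating-tail d m (_ ∷ _) (_ , a) = a

alternating-prefix : ∀ d w r → Alternating d (w ++ r) → Alternating d w
alternating-prefix d []          r _       = tt
alternating-prefix d (x ∷ [])    r _       = tt
alternating-prefix d (x ∷ y ∷ w) r (s , a) = s , alternating-prefix (flip d) (y ∷ w) r a

maximum-¬up : ∀ {m w} → All (_< m) w → w ≢ [] → ¬ Alternating up (m ∷ w)
maximum-¬up []        ne _         = ne refl
maximum-¬up (b<m ∷ _) _  (m<b , _) = <-asym b<m m<b

maximum-down : ∀ {m w} → All (_< m) w → Alternating up w → Alternating down (m ∷ w)
maximum-down []        _ = tt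
maximum-down (b<m ∷ _) a = b<m , a

module _ {m : ℕ} {w₂ : List ℕ} (m>w₂ : All (_< m) w₂) where

  -- The one-letter word has to be excluded: it alternates in both directions, yet for `up` its
  -- letter is not at a peak.
  alternating-peak⁻ : ∀ d w₁ → All (_< m) w₁ → w₁ ++ w₂ ≢ [] →
    Alternating d (w₁ ++ m ∷ w₂) → Peak d (length w₁) × Alternating d w₁ × Alternating up w₂
  alternating-peak⁻ up [] _ ne a = contradiction a (maximum-¬up m>w₂ ne)
  alternating-peak⁻ down [] _ ne a = tt , tt , alternating-tail down m w₂ a
  alternating-peak⁻ up (x ∷ []) _ ne (_ , a) = tt , tt , alternating-tail down m w₂ a
  alternating-peak⁻ down (x ∷ []) (x<m ∷ _) ne (m<x , _) = contradiction m<x (<-asym x<m)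
  alternating-peak⁻ d (x ∷ y ∷ w) (_ ∷ lt) ne (s , a) =
    let p , a₁ , a₂ = alternating-peak⁻ (flip d) (y ∷ w) lt (λ ()) a in p , (s , a₁) , a₂

  alternating-peak⁺ : ∀ d w₁ → All (_< m) w₁ → Peak d (length w₁) →
    Alternating d w₁ → Alternating up w₂ → Alternating d (w₁ ++ m ∷ w₂)
  alternating-peak⁺ down [] _ p _ a₂ = maximum-down m>w₂ a₂
  alternating-peak⁺ up (x ∷ []) (x<m ∷ _) p _ a₂ =
    x<m , maximum-down m>w₂ a₂
  alternating-peak⁺ d (x ∷ y ∷ w) (_ ∷ lt) p (s , a₁) a₂ =
    s , alternating-peak⁺ (flip d) (y ∷ w) lt p a₁ a₂

-- The peak is the position after `a`, where the maximum will stand; so `a` itself fills a valley.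
alternating-valley⁺ : ∀ d w {a} → All (a <_) w → Peak d (suc (length w)) →
  Alternating d w → Alternating d (w ++ [ a ])
alternating-valley⁺ d    []          _         _ _        = tt
alternating-valley⁺ down (x ∷ [])    (a<x ∷ _) _ _        = a<x , tt
alternating-valley⁺ d    (x ∷ y ∷ w) (_ ∷ lt)  p (s , a)  =
  s , alternating-valley⁺ (flip d) (y ∷ w) lt p a

-- Occurrences of 1-3-2

-- Definitionally the summand of `pairs132`: the occurrences with first entry `x` and middle entry
-- `y`.
between : ℕ → ℕ → List ℕ → ℕ
between x y zs = length (filter (λ z → T? ((x <ᵇ z) ∧ (z <ᵇ y))) zs)

between-in : ∀ {x y z} zs → x < z → z < y → between x y (z ∷ zs) ≡ suc (between x y zs)
between-in {x} {y} zs x<z z<y = cong length (filter-accept (λ z → T? ((x <ᵇ z) ∧ (z <ᵇ y)))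
  (Equivalence.from T-∧ (<⇒<ᵇ x<z , <⇒<ᵇ z<y)))

between-out : ∀ {x y z} zs → ¬ (x < z × z < y) → between x y (z ∷ zs) ≡ between x y zs
between-out {x} {y} {z} zs absent = cong length (filter-reject (λ z → T? ((x <ᵇ z) ∧ (z <ᵇ y)))
  (λ t → let p , q = Equivalence.to (T-∧ {x <ᵇ z}) t in absent (<ᵇ⇒< x z p , <ᵇ⇒< z y q)))

between-++ : ∀ x y zs zs′ → between x y (zs ++ zs′) ≡ between x y zs + between x y zs′
between-++ x y zs zs′ = trans (cong length (filter-++ _ zs zs′)) (length-++ (filter _ zs))

between-↭ : ∀ x y {zs zs′} → zs ↭ zs′ → between x y zs ≡ between x y zs′
between-↭ x y p = ↭-length (filter-↭ _ p)

between-none : ∀ {x y} zs → (∀ {z} → z ∈ zs → x < z → z < y → ⊥) → between x y zs ≡ 0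
between-none []       absent = refl
between-none (z ∷ zs) absent = trans (between-out zs (λ (p , q) → absent (here refl) p q))
                                 (between-none zs (absent ∘ there))

between-some : ∀ {x y z} zs → z ∈ zs → x < z → z < y → 1 ≤ between x y zs
between-some {x} {y} {z} (z′ ∷ zs) (here refl) p q =
  subst (1 ≤_) (sym (between-in zs p q)) (s≤s z≤n)
between-some {x} {y} {z} (z′ ∷ zs) (there i) p q =
  ≤-trans (between-some zs i p q)
    (subst (between x y zs ≤_) (sym (between-++ x y [ z′ ] zs)) (m≤n+m _ _))

between≡0⇒≤ : ∀ {x y} zs → All (_< y) zs → between x y zs ≡ 0 → ∀ {z} → z ∈ zs → z ≤ x
between≡0⇒≤ {x} zs lt eq {z} i with z ≤? x
... | yes z≤x = z≤x
... | no  z≰x with () ← subst (1 ≤_) eq (between-some zs i (≰⇒> z≰x) (All.lookup lt i))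

between≡1⇒↭ : ∀ {x y} zs → All (_< y) zs → between x y zs ≡ 1 →
  ∃₂ λ c zs′ → zs ↭ c ∷ zs′ × x < c × (∀ {z} → z ∈ zs′ → z ≤ x)
between≡1⇒↭ {x} {y} (z ∷ zs) (z<y ∷ lt) eq with x <? z
... | yes x<z = z , zs , ↭-refl , x<z ,
  between≡0⇒≤ zs lt (suc-injective (trans (sym (between-in zs x<z z<y)) eq))
... | no x≮z with between≡1⇒↭ zs lt (trans (sym (between-out {x} {y} zs (x≮z ∘ proj₁))) eq)
...   | c , zs′ , p , x<c , le =
        c , z ∷ zs′ , ↭-trans (prep z p) (swap z c ↭-refl) , x<c ,
        (λ { (here refl) → ≮⇒≥ x≮z ; (there i) → le i })

pairs-none : ∀ {x} zs → (∀ {y z} → y ∈ zs → z ∈ zs → x < z → z < y → ⊥) → pairs132 x zs ≡ 0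
pairs-none []       absent = refl
pairs-none (y ∷ zs) absent = cong₂ _+_
  (between-none zs (absent (here refl) ∘ there))
  (pairs-none zs (λ i j → absent (there i) (there j)))

pairs-++ : ∀ x w r → pairs132 x r ≡ 0 → (∀ {y} → y ∈ w → between x y r ≡ 0) →
  pairs132 x (w ++ r) ≡ pairs132 x w
pairs-++ x []      r p b = p
pairs-++ x (y ∷ w) r p b = cong₂ _+_
  (trans (between-++ x y w r) (trans (cong (between x y w +_) (b (here refl))) (+-identityʳ _)))
  (pairs-++ x w r p (b ∘ there))

occ-++ : ∀ w r → (∀ {x} → x ∈ w → pairs132 x r ≡ 0) →
  (∀ {x y} → x ∈ w → y ∈ w → between x y r ≡ 0) → occ132 (w ++ r) ≡ occ132 w + occ132 r
occ-++ []      r p b = refl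
occ-++ (x ∷ w) r p b = trans
  (cong₂ _+_ (pairs-++ x w r (p (here refl)) (b (here refl) ∘ there))
             (occ-++ w r (p ∘ there) (λ i j → b (there i) (there j))))
  (sym (+-assoc (pairs132 x w) (occ132 w) (occ132 r)))

-- Every entry counted on the left is the end of an occurrence with middle `m`.
between≤pairs : ∀ x m w₁ w₂ → between x m w₂ ≤ pairs132 x (w₁ ++ m ∷ w₂)
between≤pairs x m []       w₂ = m≤m+n _ _
between≤pairs x m (y ∷ w₁) w₂ = ≤-trans (between≤pairs x m w₁ w₂) (m≤n+m _ _)

Dominates : List ℕ → List ℕ → Set
Dominates w₁ w₂ = ∀ {x z} → x ∈ w₁ → z ∈ w₂ → z < x

Apart : List ℕ → List ℕ → Set
Apart w₁ w₂ = ∀ {x z} → x ∈ w₁ → z ∈ w₂ → z ≢ x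

module _ {m : ℕ} {w₂ : List ℕ} (m>w₂ : All (_< m) w₂) where

  occ-maximum : occ132 (m ∷ w₂) ≡ occ132 w₂
  occ-maximum = cong (_+ occ132 w₂) (pairs-none w₂
    (λ _ j p _ → <-asym p (All.lookup m>w₂ j)))

  -- A triple that starts in `w₁` cannot end in `w₂`, whose entries lie below its start, nor at `m`,
  -- which no middle entry exceeds; and `m` itself starts none.
  occ-dominates : ∀ w₁ → All (_< m) w₁ → Dominates w₁ w₂ →
    occ132 (w₁ ++ m ∷ w₂) ≡ occ132 w₁ + occ132 w₂
  occ-dominates w₁ lt dom = trans
    (occ-++ w₁ (m ∷ w₂)
      (λ i → cong₂ _+_ (between-none {y = m} w₂ (λ j p _ → <-asym p (dom i j)))
                       (pairs-none w₂ (λ _ j p _ → <-asym p (dom i j))))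
      (λ i j → between-none (m ∷ w₂)
        (λ { (here refl) _ q → <-asym q (All.lookup lt j)
           ; (there k)   p _ → <-asym p (dom i k) })))
    (cong (occ132 w₁ +_) occ-maximum)

  -- The extra occurrence is a m c.
  occ-crossing : ∀ {a c w₂′} w₀ → All (_< m) w₀ → a < m → Dominates w₀ (a ∷ w₂) →
    w₂ ↭ c ∷ w₂′ → a < c → All (_< a) w₂′ →
    occ132 (w₀ ++ a ∷ m ∷ w₂) ≡ suc (occ132 w₀ + occ132 w₂)
  occ-crossing {a} {c} {w₂′} w₀ lt a<m dom w₂↭ a<c a>w₂′ = trans
    (occ-++ w₀ (a ∷ m ∷ w₂)
      (λ i → cong₂ _+_ (between-none (m ∷ w₂) (λ _ p q → <-asym (<-trans p q) (dom i (here refl))))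
               (cong₂ _+_ (between-none {y = m} w₂ (λ j p _ → <-asym p (dom i (there j))))
                          (pairs-none w₂ (λ _ j p _ → <-asym p (dom i (there j))))))
      (λ i j → between-none (a ∷ m ∷ w₂)
        (λ { (here refl)         p _ → <-asym p (dom i (here refl))
           ; (there (here refl)) _ q → <-asym q (All.lookup lt j)
           ; (there (there k))   p _ → <-asym p (dom i (there k)) })))
    (trans (cong (occ132 w₀ +_) rest) (+-suc _ _))
    where
    ≤c : ∀ {z} → z ∈ w₂ → z ≤ c
    ≤c j with ∈-resp-↭ w₂↭ j
    ... | here refl = ≤-refl
    ... | there k   = <⇒≤ (<-trans (All.lookup a>w₂′ k) a<c)
    >a⇒≡c : ∀ {z} → z ∈ w₂ → a < z → z ≡ c
    >a⇒≡c j p with ∈-resp-↭ w₂↭ j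
    ... | here eq = eq
    ... | there k = contradiction p (<-asym (All.lookup a>w₂′ k))
    one : between a m w₂ ≡ 1
    one = trans (between-↭ a m w₂↭) (trans
      (between-in w₂′ a<c (All.lookup m>w₂ (∈-resp-↭ (↭-sym w₂↭) (here refl))))
      (cong suc (between-none {y = m} w₂′ (λ k p _ → <-asym p (All.lookup a>w₂′ k)))))
    none : pairs132 a w₂ ≡ 0
    none = pairs-none w₂ (λ i j p q → <⇒≱ (subst (_< _) (>a⇒≡c j p) q) (≤c i))
    rest : occ132 (a ∷ m ∷ w₂) ≡ suc (occ132 w₂)
    rest = cong₂ _+_ (cong₂ _+_ one none) occ-maximum

  -- A larger entry z of `w₂` behind a smaller x of `w₁` would give the occurrence x m z.
  avoids⇒dominates : ∀ w₁ → Apart w₁ w₂ → occ132 (w₁ ++ m ∷ w₂) ≡ 0 → Dominates w₁ w₂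
  avoids⇒dominates (x ∷ w₁) ap eq (here refl) j =
    ≤∧≢⇒< (between≡0⇒≤ w₂ m>w₂
            (n≤0⇒n≡0 (≤-trans (between≤pairs x m w₁ w₂) (≤-reflexive (m+n≡0⇒m≡0 _ eq)))) j)
          (ap (here refl) j)
  avoids⇒dominates (x ∷ w₁) ap eq (there i) j =
    avoids⇒dominates w₁ (ap ∘ there) (m+n≡0⇒n≡0 (pairs132 x (w₁ ++ m ∷ w₂)) eq) i j

  Crossing : List ℕ → Set
  Crossing w₁ = ∃₂ λ w₀ a → w₁ ≡ w₀ ++ [ a ] × Dominates w₀ w₂ × between a m w₂ ≡ 1

  -- Suppose x in `w₁` lies below some c in `w₂`. Then x m c is the only occurrence, so the word
  -- after x avoids 1-3-2, and any later y in `w₁` exceeds c. But then x y c is a second occurrence;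
  -- hence x is the last entry of `w₁`.
  once⇒dominates⊎crossing : ∀ w₁ → Apart w₁ w₂ → occ132 (w₁ ++ m ∷ w₂) ≡ 1 →
    Dominates w₁ w₂ ⊎ Crossing w₁
  once⇒dominates⊎crossing [] ap eq = inj₁ (λ ())
  once⇒dominates⊎crossing (x ∷ w₁) ap eq
    with pairs132 x (w₁ ++ m ∷ w₂) in pairs-x | between x m w₂ in between-x | between≤pairs x m w₁ w₂
  ... | pairs | zero | _ = extend pairs eq
    where
    x>w₂ : ∀ {z} → z ∈ w₂ → z < x
    x>w₂ j = ≤∧≢⇒< (between≡0⇒≤ w₂ m>w₂ between-x j) (ap (here refl) j)
    cons : ∀ {w} → Dominates w w₂ → Dominates (x ∷ w) w₂
    cons dom (here refl) j = x>w₂ j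
    cons dom (there i)   j = dom i j
    extend : ∀ pairs → pairs + occ132 (w₁ ++ m ∷ w₂) ≡ 1 →
      Dominates (x ∷ w₁) w₂ ⊎ Crossing (x ∷ w₁)
    -- Here the occurrence starts at `x` without having `m` in the middle, and the word after `x`
    -- avoids 1-3-2.
    extend (suc pairs) eq =
      inj₁ (cons (avoids⇒dominates w₁ (ap ∘ there) (m+n≡0⇒n≡0 pairs (suc-injective eq))))
    extend zero        eq with once⇒dominates⊎crossing w₁ (ap ∘ there) eq
    ... | inj₁ dom                       = inj₁ (cons dom)
    ... | inj₂ (w₀ , a , e , dom , one) = inj₂ (x ∷ w₀ , a , cong (x ∷_) e , cons dom , one)
  ... | suc pairs | suc k | s≤s k≤pairs = crossing w₁ pairs-x (ap ∘ there) (m+n≡0⇒n≡0 pairs (suc-injective eq))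
    where
    k≡0 : k ≡ 0
    k≡0 = n≤0⇒n≡0 (≤-trans k≤pairs (≤-reflexive (m+n≡0⇒m≡0 pairs (suc-injective eq))))
    one : between x m w₂ ≡ 1
    one = trans between-x (cong suc k≡0)
    crossing : ∀ w₁ → pairs132 x (w₁ ++ m ∷ w₂) ≡ suc pairs → Apart w₁ w₂ →
      occ132 (w₁ ++ m ∷ w₂) ≡ 0 → Dominates (x ∷ w₁) w₂ ⊎ Crossing (x ∷ w₁)
    crossing []       _   _  _ = inj₂ ([] , x , refl , (λ ()) , one)
    crossing (y ∷ w₁) eq′ ap av with between≡1⇒↭ w₂ m>w₂ one
    ... | c , _ , w₂↭ , x<c , _ = contradiction two≤1 (λ { (s≤s ()) })
      where
      c∈w₂ : c ∈ w₂
      c∈w₂ = ∈-resp-↭ (↭-sym w₂↭) (here refl)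
      -- The two occurrences are x y c and x m c.
      two≤1 : 2 ≤ 1
      two≤1 = ≤-trans
        (+-mono-≤ (between-some w₂ c∈w₂ x<c (avoids⇒dominates (y ∷ w₁) ap av (here refl) c∈w₂))
                  (≤-reflexive (sym one)))
        (≤-trans (+-mono-≤ (between-suffix w₁) (between≤pairs x m w₁ w₂))
                 (≤-reflexive (trans eq′ (cong suc (m+n≡0⇒m≡0 pairs (suc-injective eq))))))
        where
        between-suffix : ∀ w → between x y w₂ ≤ between x y (w ++ m ∷ w₂)
        between-suffix w = ≤-trans
          (≤-trans (m≤n+m _ (between x y [ m ])) (≤-reflexive (sym (between-++ x y [ m ] w₂))))
          (≤-trans (m≤n+m _ (between x y w)) (≤-reflexive (sym (between-++ x y w (m ∷ w₂)))))

-- Decomposition at the maximum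

allPairs-++ : ∀ {A : Set} {R : A → A → Set} xs {ys} → AllPairs R (xs ++ ys) →
  ∀ {x y} → x ∈ xs → y ∈ ys → R x y
allPairs-++ (x ∷ xs) (r ∷ rs) (here refl) j = All.lookup r (∈-++⁺ʳ xs j)
allPairs-++ (x ∷ xs) (r ∷ rs) (there i)   j = allPairs-++ xs rs i j

allPairs-prefix : ∀ {A : Set} {R : A → A → Set} xs {ys} → AllPairs R (xs ++ ys) → AllPairs R xs
allPairs-prefix []       _        = []
allPairs-prefix (x ∷ xs) (r ∷ rs) = All.tabulate (All.lookup r ∘ ∈-++⁺ˡ) ∷ allPairs-prefix xs rs

allPairs-suffix : ∀ {A : Set} {R : A → A → Set} xs {ys} → AllPairs R (xs ++ ys) → AllPairs R ys
allPairs-suffix []       rs       = rs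
allPairs-suffix (x ∷ xs) (_ ∷ rs) = allPairs-suffix xs rs

∉-split-unique : ∀ {A : Set} {m : A} w₁ w₁′ {w₂ w₂′} → m ∉ w₁ → m ∉ w₁′ →
  w₁ ++ m ∷ w₂ ≡ w₁′ ++ m ∷ w₂′ → w₁ ≡ w₁′ × w₂ ≡ w₂′
∉-split-unique []       []        n n′ refl = refl , refl
∉-split-unique []       (_ ∷ _)   n n′ refl = contradiction (here refl) n′
∉-split-unique (_ ∷ _)  []        n n′ refl = contradiction (here refl) n
∉-split-unique (x ∷ w₁) (_ ∷ w₁′) n n′ eq with ∷-injective eq
... | refl , eq′ with ∉-split-unique w₁ w₁′ (n ∘ there) (n′ ∘ there) eq′
...   | refl , e = refl , e

++-injective : ∀ {A : Set} (xs xs′ : List A) {ys ys′} → length xs ≡ length xs′ →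
  xs ++ ys ≡ xs′ ++ ys′ → xs ≡ xs′
++-injective []       []         _ _  = refl
++-injective (x ∷ xs) (x′ ∷ xs′) l eq with ∷-injective eq
... | refl , eq′ = cong (x ∷_) (++-injective xs xs′ (suc-injective l) eq′)

Descending : List ℕ → Set
Descending = AllPairs _>_

-- While `w₁` is nonempty, the largest letter cannot lie in `w₂`, since it would have to be smaller
-- than an entry of `w₁`. It is therefore removed from `w₁` and becomes the head of `V₁`.
split-descending : ∀ {V} w₁ w₂ → Descending V → w₁ ++ w₂ ↭ V → Dominates w₁ w₂ →
  ∃₂ λ V₁ V₂ → V ≡ V₁ ++ V₂ × w₁ ↭ V₁ × w₂ ↭ V₂
split-descending {V} [] w₂ desc p dom = [] , V , refl , ↭-refl , p
split-descending {[]} (x ∷ w₁) w₂ desc p dom = contradiction p ¬x∷xs↭[]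
split-descending {v ∷ V} w₁@(x ∷ _) w₂ (v> ∷ desc) p dom
  with ∈-++⁻ w₁ (∈-resp-↭ (↭-sym p) (here refl))
... | inj₂ v∈w₂ = contradiction (dom (here refl) v∈w₂) (≤⇒≯ (x≤v (∈-resp-↭ p (here refl))))
  where
  x≤v : x ∈ v ∷ V → x ≤ v
  x≤v (here refl) = ≤-refl
  x≤v (there i)   = <⇒≤ (All.lookup v> i)
... | inj₁ v∈w₁ with ∈-∃++ v∈w₁
...   | l , r , eq with split-descending (l ++ r) w₂ desc rest dom′
  where
  rest : (l ++ r) ++ w₂ ↭ V
  rest = ↭-trans (↭-reflexive (++-assoc l r w₂)) (drop-mid l []
    (↭-trans (↭-reflexive (trans (sym (++-assoc l (v ∷ r) w₂)) (cong (_++ w₂) (sym eq)))) p))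
  dom′ : Dominates (l ++ r) w₂
  dom′ {y} i j = dom (subst (y ∈_) (sym eq) (∈-resp-↭ (↭-sym (↭-shift v l r)) (there i))) j
...     | V₁ , V₂ , refl , p₁ , p₂ =
          v ∷ V₁ , V₂ , refl , ↭-trans (↭-reflexive eq) (↭-trans (↭-shift v l r) (prep v p₁)) , p₂

-- The letters form an arbitrary descending list V, so that the parts of a word
-- need not be standardised.
Word : ℕ → Direction → List ℕ → List ℕ → Set
Word k d V w = w ↭ V × Alternating d w × occ132 w ≡ k

-- `length V` is the position of the maximum. The maximum itself is attached to the right part, so
-- that words are glued by plain concatenation.
Left : ℕ → Direction → List ℕ → List ℕ → Set
Left k d V w = Word k d V w × Peak d (length V)

Right : ℕ → ℕ → List ℕ → List ℕ → Set
Right k m V w = ∃ λ w₂ → w ≡ m ∷ w₂ × Word k up V w₂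

-- If m is part of the occurrence, then V = V₁ ++ c ∷ a ∷ V₂ and w = w₀ ++ a ∷ m ∷ w₂
-- with w₀ ↭ V₁ and w₂ ↭ c ∷ V₂.
CrossLeft : Direction → List ℕ → List ℕ → Set
CrossLeft d V w = Word 0 d V w × Peak d (suc (length V))

CrossRight : ℕ → List ℕ → List ℕ → Set
CrossRight m (c ∷ a ∷ V) w = ∃ λ w₂ → w ≡ a ∷ m ∷ w₂ × Word 0 up (c ∷ V) w₂
CrossRight m _           w = ⊥

module _ {m : ℕ} {V : List ℕ} (desc : Descending (m ∷ V)) where

  private
    m>V : All (_< m) V
    m>V = AllPairs.head desc

    below : ∀ {w} → (∀ {x} → x ∈ w → x ∈ V) → All (_< m) w
    below sub = All.tabulate (All.lookup m>V ∘ sub)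

    belowˡ : ∀ V₁ V₂ {w} → V ≡ V₁ ++ V₂ → w ↭ V₁ → All (_< m) w
    belowˡ V₁ V₂ refl p = below (∈-++⁺ˡ ∘ ∈-resp-↭ p)

    belowʳ : ∀ V₁ V₂ {w} → V ≡ V₁ ++ V₂ → w ↭ V₂ → All (_< m) w
    belowʳ V₁ V₂ refl p = below (∈-++⁺ʳ V₁ ∘ ∈-resp-↭ p)

    ∉-below : ∀ {w} → All (_< m) w → m ∉ w
    ∉-below lt i = <-irrefl refl (All.lookup lt i)

    dominates : ∀ V₁ V₂ {w₁ w₂} → V ≡ V₁ ++ V₂ → w₁ ↭ V₁ → w₂ ↭ V₂ → Dominates w₁ w₂
    dominates V₁ V₂ refl p₁ p₂ i j =
      allPairs-++ V₁ (AllPairs.tail desc) (∈-resp-↭ p₁ i) (∈-resp-↭ p₂ j)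

  glue⇒word : ∀ {k l d w} → Glue (Left k d) (Right l m) V w → Word (k + l) d (m ∷ V) w
  glue⇒word {d = d} (V₁ , V₂ , refl , w₁ , _ , ((p₁ , a₁ , o₁) , peak) , (w₂ , refl , p₂ , a₂ , o₂) , refl) =
    ↭-trans (↭-shift m w₁ w₂) (prep m (↭-++⁺ p₁ p₂)) ,
    alternating-peak⁺ lt₂ d w₁ lt₁ (subst (Peak d) (sym (↭-length p₁)) peak) a₁ a₂ ,
    trans (occ-dominates lt₂ w₁ lt₁ (dominates V₁ V₂ refl p₁ p₂)) (cong₂ _+_ o₁ o₂)
    where
    lt₁ = belowˡ V₁ V₂ refl p₁
    lt₂ = belowʳ V₁ V₂ refl p₂

  crossing⇒word : ∀ {d w} → Glue (CrossLeft d) (CrossRight m) V w → Word 1 d (m ∷ V) w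
  crossing⇒word {d} (V₁ , c ∷ a ∷ V₃ , refl , w₀ , _ , ((p₀ , a₀ , o₀) , peak) , (w₂ , refl , p₂ , a₂ , o₂) , refl) =
    perm ,
    subst (Alternating d) (++-assoc w₀ [ a ] (m ∷ w₂))
      (alternating-peak⁺ lt₂ d (w₀ ++ [ a ]) lt₁
        (subst (Peak d) (sym len) peak)
        (alternating-valley⁺ d w₀ (All.tabulate (λ i → dom i (here refl)))
          (subst (λ n → Peak d (suc n)) (sym (↭-length p₀)) peak) a₀)
        a₂) ,
    trans (occ-crossing lt₂ w₀ lt₀ a<m dom p₂ a<c a>V₃) (cong suc (cong₂ _+_ o₀ o₂))
    where
    desc₂ : Descending (c ∷ a ∷ V₃)
    desc₂ = allPairs-suffix V₁ (AllPairs.tail desc)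
    a<c : a < c
    a<c = All.head (AllPairs.head desc₂)
    a>V₃ : All (_< a) V₃
    a>V₃ = AllPairs.head (AllPairs.tail desc₂)
    w₂⊆ : ∀ {x} → x ∈ w₂ → x ∈ c ∷ a ∷ V₃
    w₂⊆ i with ∈-resp-↭ p₂ i
    ... | here e  = here e
    ... | there j = there (there j)
    a<m : a < m
    a<m = All.lookup m>V (∈-++⁺ʳ V₁ (there (here refl)))
    lt₀ : All (_< m) w₀
    lt₀ = belowˡ V₁ _ refl p₀
    lt₁ : All (_< m) (w₀ ++ [ a ])
    lt₁ = below (λ i → ∈-++ (∈-++⁻ w₀ i))
      where
      ∈-++ : ∀ {x} → x ∈ w₀ ⊎ x ∈ [ a ] → x ∈ V₁ ++ c ∷ a ∷ V₃
      ∈-++ (inj₁ i)           = ∈-++⁺ˡ (∈-resp-↭ p₀ i)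
      ∈-++ (inj₂ (here refl)) = ∈-++⁺ʳ V₁ (there (here refl))
    lt₂ : All (_< m) w₂
    lt₂ = below (∈-++⁺ʳ V₁ ∘ w₂⊆)
    dom : Dominates w₀ (a ∷ w₂)
    dom i (here refl) = allPairs-++ V₁ (AllPairs.tail desc) (∈-resp-↭ p₀ i) (there (here refl))
    dom i (there j)   = allPairs-++ V₁ (AllPairs.tail desc) (∈-resp-↭ p₀ i) (w₂⊆ j)
    len : length (w₀ ++ [ a ]) ≡ suc (length V₁)
    len = trans (length-++ w₀) (trans (+-comm _ 1) (cong suc (↭-length p₀)))
    perm : w₀ ++ a ∷ m ∷ w₂ ↭ m ∷ V₁ ++ c ∷ a ∷ V₃
    perm = ↭-trans
      (↭-++⁺ p₀ (↭-trans (swap a m p₂) (prep m (swap a c ↭-refl))))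
      (↭-shift m V₁ (c ∷ a ∷ V₃))

  -- The left part does not contain `m`, so the place of `m` determines both parts; the cut of `V`
  -- is then determined by the length of the left part.
  glue-unique : ∀ {k l d} → UniqueGlue (Left k d) (Right l m) V
  glue-unique {V₁ = V₁} {V₂} {V₁′} {V₂′} {w₁} {_} {w₁′} e e′ ((p , _) , _) (_ , refl , _) ((p′ , _) , _) (_ , refl , _) eq
    with ∉-split-unique w₁ w₁′ (∉-below (belowˡ V₁ V₂ e p)) (∉-below (belowˡ V₁′ V₂′ e′ p′)) eq
  ... | refl , refl = ++-injective V₁ V₁′ (trans (sym (↭-length p)) (↭-length p′)) (trans (sym e) e′)
                    , refl , refl

  crossing-split : ∀ {d V₁ V₂ w₁ w₂} → V ≡ V₁ ++ V₂ → CrossLeft d V₁ w₁ → CrossRight m V₂ w₂ →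
    ∃₂ λ a w → w₂ ≡ a ∷ m ∷ w × m ∉ (w₁ ++ [ a ]) × (∃ λ c → c ∈ w × a < c)
  crossing-split {V₁ = V₁} {c ∷ a ∷ V₂} {w₁} refl ((p , _) , _) (w , refl , p₂ , _) =
    a , w , refl ,
    (λ i → m∉ (∈-++⁻ w₁ i)) ,
    c , ∈-resp-↭ (↭-sym p₂) (here refl) ,
    All.head (AllPairs.head (allPairs-suffix V₁ (AllPairs.tail desc)))
    where
    m∉ : m ∈ w₁ ⊎ m ∈ [ a ] → ⊥
    m∉ (inj₁ i)           = ∉-below (belowˡ V₁ _ refl p) i
    m∉ (inj₂ (here refl)) = <-irrefl refl (All.lookup m>V (∈-++⁺ʳ V₁ (there (here refl))))

  private
    regroup : ∀ w₁ a {w : List ℕ} → w₁ ++ a ∷ m ∷ w ≡ (w₁ ++ [ a ]) ++ m ∷ w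
    regroup w₁ a = sym (++-assoc w₁ [ a ] _)

  crossing-unique : ∀ {d} → UniqueGlue (CrossLeft d) (CrossRight m) V
  crossing-unique {d} {V₁} {V₂} {V₁′} {V₂′} {w₁} {_} {w₁′} e e′ l@((p , _) , _) r l′@((p′ , _) , _) r′ eq
    with crossing-split {d} {V₁} {V₂} e l r | crossing-split {d} {V₁′} {V₂′} e′ l′ r′
  ... | a , w , refl , n , _ | a′ , w′ , refl , n′ , _
    with ∉-split-unique (w₁ ++ [ a ]) (w₁′ ++ [ a′ ]) n n′
           (trans (sym (regroup w₁ a)) (trans eq (regroup w₁′ a′)))
  ...   | eq₁ , refl with ∷ʳ-injective w₁ w₁′ eq₁
  ...     | refl , refl =
            ++-injective V₁ V₁′ (trans (sym (↭-length p)) (↭-length p′)) (trans (sym e) e′) , refl , refl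

  glue-disjoint : ∀ {k l k′ l′ d w} → k ≢ k′ →
    Glue (Left k d) (Right l m) V w → Glue (Left k′ d) (Right l′ m) V w → ⊥
  glue-disjoint k≢k′
    (V₁ , V₂ , e , w₁ , _ , ((p , _ , o) , _) , (_ , refl , _) , refl)
    (V₁′ , V₂′ , e′ , w₁′ , _ , ((p′ , _ , o′) , _) , (_ , refl , _) , eq)
    with ∉-split-unique w₁ w₁′ (∉-below (belowˡ V₁ V₂ e p)) (∉-below (belowˡ V₁′ V₂′ e′ p′)) eq
  ... | refl , _ = k≢k′ (trans (sym o) o′)

  -- In a glued word everything before `m` exceeds everything after it, whereas a crossing word has
  -- a < c on the two sides of `m`.
  glue-crossing-disjoint : ∀ {k l d d′ w} →
    Glue (Left k d) (Right l m) V w → Glue (CrossLeft d′) (CrossRight m) V w → ⊥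
  glue-crossing-disjoint {d′ = d′}
    (V₁ , V₂ , e , w₁ , _ , ((p , _) , _) , (_ , refl , p₂ , _) , refl)
    (V₁′ , V₂′ , e′ , w₁′ , _ , l , r , eq)
    with crossing-split {d′} {V₁′} {V₂′} e′ l r
  ... | a , w , refl , n , c , c∈w , a<c
    with ∉-split-unique w₁ (w₁′ ++ [ a ]) (∉-below (belowˡ V₁ V₂ e p)) n (trans eq (regroup w₁′ a))
  ...   | refl , refl = <-asym a<c (dominates V₁ V₂ e p p₂ (∈-++⁺ʳ w₁′ (here refl)) c∈w)

  record Decomposition (d : Direction) (w : List ℕ) : Set where
    field
      w₁ w₂ : List ℕ
      split : w ≡ w₁ ++ m ∷ w₂
      perm  : w₁ ++ w₂ ↭ V
      m>w₁  : All (_< m) w₁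
      m>w₂  : All (_< m) w₂
      peak  : Peak d (length w₁)
      alt₁  : Alternating d w₁
      alt₂  : Alternating up w₂

    apart : Apart w₁ w₂
    apart i j eq = allPairs-++ w₁
      (Unique-resp-↭ (setoid ℕ) (↭⇒↭ₛ (↭-sym perm)) (AllPairs.map >⇒≢ (AllPairs.tail desc)))
      i j (sym eq)

    dominates⇒glue : Dominates w₁ w₂ → Glue (Left (occ132 w₁) d) (Right (occ132 w₂) m) V w
    dominates⇒glue dom with split-descending w₁ w₂ (AllPairs.tail desc) perm dom
    ... | V₁ , V₂ , e , p₁ , p₂ =
      V₁ , V₂ , e , w₁ , m ∷ w₂ ,
      ((p₁ , alt₁ , refl) , subst (Peak d) (↭-length p₁) peak) , (w₂ , refl , p₂ , alt₂ , refl) , split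

  decompose : ∀ {k d w} → V ≢ [] → Word k d (m ∷ V) w → Decomposition d w
  decompose {d = d} V≢[] (p , alt , _) with ∈-∃++ (∈-resp-↭ (↭-sym p) (here refl))
  ... | w₁ , w₂ , refl = record
    { w₁ = w₁ ; w₂ = w₂ ; split = refl ; perm = perm ; m>w₁ = lt₁ ; m>w₂ = lt₂
    ; peak = proj₁ parts ; alt₁ = proj₁ (proj₂ parts) ; alt₂ = proj₂ (proj₂ parts) }
    where
    perm : w₁ ++ w₂ ↭ V
    perm = drop-mid w₁ [] p
    lt₁ = below (∈-resp-↭ perm ∘ ∈-++⁺ˡ)
    lt₂ = below (∈-resp-↭ perm ∘ ∈-++⁺ʳ w₁)
    nonempty : w₁ ++ w₂ ≢ []
    nonempty eq = V≢[] (↭-empty-inv (↭-trans (↭-sym perm) (↭-reflexive eq)))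
    parts = alternating-peak⁻ lt₂ d w₁ lt₁ nonempty alt

  word⇒glue : ∀ {d w} → V ≢ [] → Word 0 d (m ∷ V) w → Glue (Left 0 d) (Right 0 m) V w
  word⇒glue {d} V≢[] word@(_ , _ , occ) with decompose V≢[] word
  ... | D@record { w₁ = w₁ ; w₂ = w₂ ; split = refl } =
    subst (λ (k , l) → Glue (Left k d) (Right l m) V (w₁ ++ m ∷ w₂)) (zeros total) (dominates⇒glue dom)
    where
    open Decomposition D using (m>w₁; m>w₂; apart; dominates⇒glue)
    dom : Dominates w₁ w₂
    dom = avoids⇒dominates m>w₂ w₁ apart occ
    total : occ132 w₁ + occ132 w₂ ≡ 0
    total = trans (sym (occ-dominates m>w₂ w₁ m>w₁ dom)) occ
    zeros : ∀ {k l} → k + l ≡ 0 → (k , l) ≡ (0 , 0)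
    zeros {zero} refl = refl

  word⇒glue⊎crossing : ∀ {d w} → V ≢ [] → Word 1 d (m ∷ V) w →
    (Glue (Left 1 d) (Right 0 m) V w ⊎ Glue (Left 0 d) (Right 1 m) V w)
      ⊎ Glue (CrossLeft d) (CrossRight m) V w
  word⇒glue⊎crossing {d} V≢[] word@(_ , _ , occ) with decompose V≢[] word
  ... | D@record { w₁ = w₁ ; w₂ = w₂ ; split = refl }
    with once⇒dominates⊎crossing (Decomposition.m>w₂ D) w₁ (Decomposition.apart D) occ
  ...   | inj₁ dom = inj₁ (cases total (dominates⇒glue dom))
    where
    open Decomposition D using (m>w₁; m>w₂; dominates⇒glue)
    total : occ132 w₁ + occ132 w₂ ≡ 1
    total = trans (sym (occ-dominates m>w₂ w₁ m>w₁ dom)) occ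
    cases : ∀ {k l} → k + l ≡ 1 → Glue (Left k d) (Right l m) V (w₁ ++ m ∷ w₂) →
      Glue (Left 1 d) (Right 0 m) V (w₁ ++ m ∷ w₂) ⊎ Glue (Left 0 d) (Right 1 m) V (w₁ ++ m ∷ w₂)
    cases {zero}     {suc zero} refl g = inj₂ g
    cases {suc zero} {zero}     refl g = inj₁ g
  ...   | inj₂ (w₀ , a , refl , dom , one)
    with between≡1⇒↭ w₂ (Decomposition.m>w₂ D) one
  ...     | c , w₂′ , w₂↭ , a<c , ≤a = inj₂ glued
    where
    open Decomposition D using (m>w₁; m>w₂; apart; perm; peak; alt₁; alt₂)
    a>w₂′ : ∀ {z} → z ∈ w₂′ → z < a
    a>w₂′ i = ≤∧≢⇒< (≤a i) (apart (∈-++⁺ʳ w₀ (here refl)) (∈-resp-↭ (↭-sym w₂↭) (there i)))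
    dom₀ : Dominates w₀ (a ∷ w₂)
    dom₀ i (here refl) = <-trans a<c (dom i (∈-resp-↭ (↭-sym w₂↭) (here refl)))
    dom₀ i (there j)   = dom i j
    dom₁ : Dominates [ c ] (a ∷ w₂′)
    dom₁ (here refl) (here refl) = a<c
    dom₁ (here refl) (there j)   = <-trans (a>w₂′ j) a<c
    dom₂ : Dominates [ a ] w₂′
    dom₂ (here refl) j = a>w₂′ j
    occ′ : occ132 w₀ + occ132 w₂ ≡ 0
    occ′ = suc-injective (trans
      (sym (occ-crossing m>w₂ w₀ (All.tabulate (All.lookup m>w₁ ∘ ∈-++⁺ˡ))
        (All.lookup m>w₁ (∈-++⁺ʳ w₀ (here refl))) dom₀ w₂↭ a<c (All.tabulate a>w₂′)))
      (trans (cong occ132 (regroup w₀ a)) occ))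
    glued : Glue (CrossLeft d) (CrossRight m) V ((w₀ ++ [ a ]) ++ m ∷ w₂)
    -- Cutting off `w₀`, then `c`, then `a`, each of which dominates all that remains, shows that
    -- `c` and `a` are adjacent in `V`.
    glued with split-descending w₀ (a ∷ w₂) (AllPairs.tail desc)
                 (↭-trans (↭-reflexive (sym (++-assoc w₀ [ a ] w₂))) perm) dom₀
    ... | V₁ , R , refl , p₀ , pR
      with split-descending [ c ] (a ∷ w₂′) (allPairs-suffix V₁ (AllPairs.tail desc))
             (↭-trans (↭-trans (swap c a ↭-refl) (prep a (↭-sym w₂↭))) pR) dom₁
    ...   | _ , R′ , refl , pc , pR′
      with ↭-singleton-inv (↭-sym pc)
    ...     | refl
      with split-descending [ a ] w₂′ (AllPairs.tail (allPairs-suffix V₁ (AllPairs.tail desc))) pR′ dom₂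
    ...       | _ , V₃ , refl , pa , p₃
      with ↭-singleton-inv (↭-sym pa)
    ...         | refl =
      V₁ , c ∷ a ∷ V₃ , refl , w₀ , a ∷ m ∷ w₂ ,
      ((p₀ , alternating-prefix d w₀ [ a ] alt₁ , m+n≡0⇒m≡0 _ occ′) ,
        subst (Peak d) (trans (length-++ w₀) (trans (+-comm _ 1) (cong suc (↭-length p₀)))) peak) ,
      (w₂ , refl , ↭-trans w₂↭ (prep c p₃) , alt₂ , m+n≡0⇒n≡0 (occ132 w₀) occ′) ,
      sym (regroup w₀ a)

-- Counting words

ladder-z· : ∀ {G} → Ladder G → Ladder (λ k → z· (G k))
ladder-z· {G} lg k n = trans (z·-cong (lg k) n) (z·-⊕ (G k) (z· (G (2 + k))) n)

ladder-double : ∀ {G} → Ladder G → Ladder (λ k → double (G k))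
ladder-double {G} lg k n = begin
  2 * G (suc k) n                       ≡⟨ cong (2 *_) (lg k n) ⟩
  2 * (G k n + z· (G (2 + k)) n)        ≡⟨ *-distribˡ-+ 2 (G k n) _ ⟩
  2 * G k n + 2 * z· (G (2 + k)) n      ≡⟨ cong (2 * G k n +_) (z·-double (G (2 + k)) n) ⟩
  2 * G k n + z· (double (G (2 + k))) n ∎

⊛-ladder : ∀ {G} → Ladder G → ∀ k l → catalanPower l ⊛ G k ≗ G (l + k)
⊛-ladder {G} lg k l n = trans (⊛-comm (catalanPower l) (G k) n) (ladder-⊛ lg k l n)

-- A count for words of length n is the coefficient of zᵐ in the Even series if n = 2m
-- and in the Odd series if n = 2m + 1.
avoidEven avoidOdd onceEven onceOdd : Direction → Series
avoidEven d    = catalanPower 1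
avoidOdd  up   = catalanPower 1
avoidOdd  down = catalanPower 2
onceEven  d    = z· (z· (double (binomialLadder 3)))
onceOdd   up   = z· (binomialLadder 2)
onceOdd   down = z· (z· (double (double (binomialLadder 4)) ⊕ catalanPower 4))

avoiding once : Direction → Series
avoiding d = interleave (avoidEven d) (avoidOdd d)
once     d = interleave (onceEven d) (onceOdd d)

-- crossing (2 + n) = avoiding up (1 + n)
crossing : Series
crossing = interleave (z· (catalanPower 1)) (z· (catalanPower 2))

-- `Peak up n` holds exactly for odd `n` and `Peak down n` exactly for even `n`.
peaks : Direction → Series → Series → Series
peaks up   f g = interleave 𝟎 g
peaks down f g = interleave f 𝟎

-- All products are C · C = C². On the left, `catalanPower 1 (suc m)` reduces to `catalanPower 2 m`,
-- which is C = 1 + zC² read off above degree 0.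
avoiding-recurrence : ∀ d n →
  avoiding d (2 + n) ≡ (peaks d (avoidEven d) (avoidOdd d) ⊛ avoiding up) (suc n)
avoiding-recurrence up n = sym (trans
  (odds-⊛ (catalanPower 1) (catalanPower 1) (catalanPower 1) (suc n))
  (interleave-cong (ladder-⊛ catalanPower-ladder 1 1) (ladder-⊛ catalanPower-ladder 1 1) n))
avoiding-recurrence down n = sym (trans
  (evens-⊛ (catalanPower 1) (catalanPower 1) (catalanPower 1) (suc n))
  (interleave-cong (ladder-⊛ catalanPower-ladder 1 1) (ladder-⊛ catalanPower-ladder 1 1 ∘ suc) n))

interleave-⊕₃ : ∀ {f f₁ f₂ f₃ g g₁ g₂ g₃} → f ≗ f₁ ⊕ f₂ ⊕ f₃ → g ≗ g₁ ⊕ g₂ ⊕ g₃ →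
  interleave f g ≗ interleave f₁ g₁ ⊕ interleave f₂ g₂ ⊕ interleave f₃ g₃
interleave-⊕₃ {f} {f₁} {f₂} {f₃} {g} {g₁} {g₂} {g₃} p q n = begin
  interleave f g n                                          ≡⟨ interleave-cong p q n ⟩
  interleave (f₁ ⊕ f₂ ⊕ f₃) (g₁ ⊕ g₂ ⊕ g₃) n                ≡⟨ interleave-⊕ (f₁ ⊕ f₂) (g₁ ⊕ g₂) f₃ g₃ n ⟩
  interleave (f₁ ⊕ f₂) (g₁ ⊕ g₂) n + interleave f₃ g₃ n     ≡⟨ cong (_+ interleave f₃ g₃ n) (interleave-⊕ f₁ g₁ f₂ g₂ n) ⟩
  interleave f₁ g₁ n + interleave f₂ g₂ n + interleave f₃ g₃ n ∎

module _ where
  open +-*-Solver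

  private
    Pow Bin : ℕ → Series
    Pow = catalanPower
    Bin = binomialLadder

    zPow : Ladder (λ k → z· (Pow k))
    zPow = ladder-z· catalanPower-ladder

    zBin : Ladder (λ k → z· (Bin k))
    zBin = ladder-z· binomialLadder-ladder

    zz2Bin : Ladder (λ k → z· (z· (double (Bin k))))
    zz2Bin = ladder-z· (ladder-z· (ladder-double binomialLadder-ladder))

    -- After division by z: one of the two copies of BC³ is replaced by C³ + 2zBC⁴.
    onceEven-sum : z· (double (Bin 3)) ≗ z· (Bin 3) ⊕ z· (z· (double (Bin 4))) ⊕ z· (Pow 3)
    onceEven-sum zero    = refl
    onceEven-sum (suc n) = begin
      2 * Bin 3 n
        ≡⟨ solve 1 (λ x → con 2 :* x := x :+ x) refl (Bin 3 n) ⟩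
      Bin 3 n + Bin 3 n
        ≡⟨ cong (Bin 3 n +_) (trans (ladder-unfold 3 n) (+-comm (Pow 3 n) _)) ⟩
      Bin 3 n + (z· (double (Bin 4)) n + Pow 3 n)
        ≡⟨ +-assoc (Bin 3 n) _ _ ⟨
      Bin 3 n + z· (double (Bin 4)) n + Pow 3 n ∎

    onceOdd-sum : Bin 2 ≗ z· (Bin 3) ⊕ z· (Bin 3) ⊕ Pow 2
    onceOdd-sum n = begin
      Bin 2 n                            ≡⟨ ladder-unfold 2 n ⟩
      Pow 2 n + z· (double (Bin 3)) n      ≡⟨ cong (Pow 2 n +_) (z·-double (Bin 3) n) ⟨
      Pow 2 n + 2 * z· (Bin 3) n           ≡⟨ solve 2 (λ t x → t :+ con 2 :* x := x :+ x :+ t) refl (Pow 2 n) (z· (Bin 3) n) ⟩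
      z· (Bin 3) n + z· (Bin 3) n + Pow 2 n  ∎

    onceOdd-sum′ : z· (double (double (Bin 4)) ⊕ Pow 4) ≗ z· (double (Bin 4)) ⊕ z· (double (Bin 4)) ⊕ z· (Pow 4)
    onceOdd-sum′ zero    = refl
    onceOdd-sum′ (suc n) = cong (λ x → 2 * Bin 4 n + x + Pow 4 n) (+-identityʳ _)

  -- The summands place the occurrence before the maximum, after it, or across it. In the last one
  -- the left factor counts `w₀`, one letter shorter than `w₁`, so the parity is flipped.
  once-recurrence : ∀ d n →
    once d (2 + n) ≡ (peaks d (onceEven d) (onceOdd d) ⊛ avoiding up) (suc n)
                   + (peaks d (avoidEven d) (avoidOdd d) ⊛ once up) (suc n)
                   + (peaks (flip d) (avoidEven d) (avoidOdd d) ⊛ crossing) (suc n)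
  once-recurrence up n = begin
    once up (2 + n)
      ≡⟨ interleave-⊕₃ even odd n ⟩
    _ ≡⟨ cong₂ _+_ (cong₂ _+_ (odds-⊛ (z· (Bin 2)) (Pow 1) (Pow 1) (suc n))
                              (odds-⊛ (Pow 1) (onceEven up) (onceOdd up) (suc n)))
                   (evens-⊛ (Pow 1) (z· (Pow 1)) (z· (Pow 2)) (suc n)) ⟨
    _ ∎
    where
    even : z· (double (Bin 3)) ≗
      z· (Bin 2) ⊛ Pow 1 ⊕ Pow 1 ⊛ onceEven up ⊕ Pow 1 ⊛ z· (Pow 2)
    even n = trans (onceEven-sum n) (sym (cong₂ _+_ (cong₂ _+_
      (ladder-⊛ zBin 2 1 n) (⊛-ladder zz2Bin 3 1 n)) (⊛-ladder zPow 2 1 n)))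
    odd : Bin 2 ≗ z· (Bin 2) ⊛ Pow 1 ⊕ Pow 1 ⊛ z· (Bin 2) ⊕ tail (Pow 1 ⊛ z· (Pow 1))
    odd n = trans (onceOdd-sum n) (sym (cong₂ _+_ (cong₂ _+_
      (ladder-⊛ zBin 2 1 n) (⊛-ladder zBin 2 1 n)) (⊛-ladder zPow 1 1 (suc n))))
  once-recurrence down n = begin
    once down (2 + n)
      ≡⟨ interleave-⊕₃ even odd n ⟩
    _ ≡⟨ cong₂ _+_ (cong₂ _+_ (evens-⊛ (onceEven down) (Pow 1) (Pow 1) (suc n))
                              (evens-⊛ (Pow 1) (onceEven up) (onceOdd up) (suc n)))
                   (odds-⊛ (Pow 2) (z· (Pow 1)) (z· (Pow 2)) (suc n)) ⟨
    _ ∎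
    where
    even : z· (double (Bin 3)) ≗
      onceEven down ⊛ Pow 1 ⊕ Pow 1 ⊛ z· (Bin 2) ⊕ Pow 2 ⊛ z· (Pow 1)
    even n = trans (onceEven-sum n) (trans
      (cong (_+ z· (Pow 3) n) (+-comm (z· (Bin 3) n) _))
      (sym (cong₂ _+_ (cong₂ _+_
        (ladder-⊛ zz2Bin 3 1 n) (⊛-ladder zBin 2 1 n)) (⊛-ladder zPow 1 2 n))))
    odd : z· (double (double (Bin 4)) ⊕ Pow 4) ≗
      tail (onceEven down ⊛ Pow 1) ⊕ tail (Pow 1 ⊛ onceEven up) ⊕ Pow 2 ⊛ z· (Pow 2)
    odd n = trans (onceOdd-sum′ n) (sym (cong₂ _+_ (cong₂ _+_
      (ladder-⊛ zz2Bin 3 1 (suc n)) (⊛-ladder zz2Bin 3 1 (suc n))) (⊛-ladder zPow 2 2 n)))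

card-peak : ∀ d n {A : Set} {P : A → Set} f g → Card P (interleave f g n) →
  Card (λ w → P w × Peak d n) (peaks d f g n)
card-peak up   zero    f g c = card-∅ proj₂
card-peak down zero    f g c = card-⇔ (_, tt) proj₁ c
card-peak up   (suc n) f g c = card-peak down n g (tail f) c
card-peak down (suc n) f g c = card-peak up n g (tail f) c

card-word-[] : ∀ d → Card (Word 0 d []) 1
card-word-[] d = card-singleton (↭-refl , tt , refl) (↭-empty-inv ∘ proj₁)

card-word-[-] : ∀ d m → Card (Word 0 d [ m ]) 1
card-word-[-] d m = card-singleton (↭-refl , tt , refl) (↭-singleton-inv ∘ proj₁)

¬once-[] : ∀ {d w} → Word 1 d [] w → 1 ≡ 0
¬once-[] (p , _ , o) with refl ← ↭-empty-inv p = sym o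

¬once-[-] : ∀ {d m w} → Word 1 d [ m ] w → 1 ≡ 0
¬once-[-] (p , _ , o) with refl ← ↭-singleton-inv p = sym o

module _ {m : ℕ} {V : List ℕ} (desc : Descending (m ∷ V)) (N : ℕ) (len : length V ≤ N) where

  private
    Count : ℕ → (Direction → Series) → Set
    Count k f = ∀ d V → length V ≤ N → Descending V → Card (Word k d V) (f d (length V))

    prefix : ∀ V₁ V₂ → V ≡ V₁ ++ V₂ → length V₁ ≤ N × Descending V₁
    prefix V₁ V₂ refl = ≤-trans (≤-trans (m≤m+n _ _) (≤-reflexive (sym (length-++ V₁)))) len ,
                        allPairs-prefix V₁ (AllPairs.tail desc)

    suffix : ∀ V₁ V₂ → V ≡ V₁ ++ V₂ → length V₂ ≤ N × Descending V₂
    suffix V₁ V₂ refl = ≤-trans (≤-trans (m≤n+m _ _) (≤-reflexive (sym (length-++ V₁)))) len ,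
                        allPairs-suffix V₁ (AllPairs.tail desc)

  card-left : ∀ {k} (f g : Direction → Series) → Count k (λ d → interleave (f d) (g d)) →
    ∀ d V₁ V₂ → V ≡ V₁ ++ V₂ → Card (Left k d V₁) (peaks d (f d) (g d) (length V₁))
  card-left f g count d V₁ V₂ e =
    let l , s = prefix V₁ V₂ e in card-peak d (length V₁) (f d) (g d) (count d V₁ l s)

  card-right : ∀ {k} (f : Direction → Series) → Count k f →
    ∀ V₁ V₂ → V ≡ V₁ ++ V₂ → Card (Right k m V₂) (f up (length V₂))
  card-right f count V₁ V₂ e =
    let l , s = suffix V₁ V₂ e in card-map (m ∷_) ∷-injectiveʳ (count up V₂ l s)

  card-crossLeft : Count 0 avoiding → ∀ d V₁ V₂ → V ≡ V₁ ++ V₂ →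
    Card (CrossLeft d V₁) (peaks (flip d) (avoidEven d) (avoidOdd d) (length V₁))
  card-crossLeft count d V₁ V₂ e =
    let l , s = prefix V₁ V₂ e
    in card-peak (flip d) (length V₁) (avoidEven d) (avoidOdd d) (count d V₁ l s)

  card-crossRight : Count 0 avoiding → ∀ V₁ V₂ → V ≡ V₁ ++ V₂ →
    Card (CrossRight m V₂) (crossing (length V₂))
  card-crossRight count V₁ []           e = card-∅ (λ ())
  card-crossRight count V₁ (_ ∷ [])     e = card-∅ (λ ())
  card-crossRight count V₁ (c ∷ a ∷ V₂) e with suffix V₁ (c ∷ a ∷ V₂) e
  ... | l , ((_ ∷ c>V₂) ∷ _ ∷ s) =
    card-map (λ w → a ∷ m ∷ w) (∷-injectiveʳ ∘ ∷-injectiveʳ)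
      -- The letter `a` has left the right part, so one letter fewer is counted there; this is the
      -- index shift in `crossing`.
      (count up (c ∷ V₂) (<⇒≤ l) (c>V₂ ∷ s))

-- The pieces of `V` are not subterms of it, so the recursion runs on a bound for the length.
-- One-letter lists are treated apart because the peak condition fails for them in direction `up`.
card-avoiding : ∀ N d V → length V ≤ N → Descending V → Card (Word 0 d V) (avoiding d (length V))
card-avoiding N       d    []              _       _    = card-word-[] d
card-avoiding N       up   (m ∷ [])        _       _    = card-word-[-] up m
card-avoiding N       down (m ∷ [])        _       _    = card-word-[-] down m
card-avoiding (suc N) d    (m ∷ V@(_ ∷ U)) (s≤s l) desc =
  subst (Card _) (sym (avoiding-recurrence d (length U)))
    (card-⇔ (glue⇒word desc) (word⇒glue desc (λ ()))
      (card-glue V (peaks d (avoidEven d) (avoidOdd d)) (avoiding up)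
        (card-left desc N l avoidEven avoidOdd (card-avoiding N) d)
        (card-right desc N l avoiding (card-avoiding N))
        (glue-unique desc)))

card-once : ∀ N d V → length V ≤ N → Descending V → Card (Word 1 d V) (once d (length V))
card-once N       d    []              _       _    = card-∅ (λ w → 1+n≢0 (¬once-[] w))
card-once N       up   (m ∷ [])        _       _    = card-∅ (λ w → 1+n≢0 (¬once-[-] w))
card-once N       down (m ∷ [])        _       _    = card-∅ (λ w → 1+n≢0 (¬once-[-] w))
card-once (suc N) d    (m ∷ V@(_ ∷ U)) (s≤s l) desc =
  subst (Card _) (sym (once-recurrence d (length U)))
    (card-⇔ (λ { (inj₁ (inj₁ g)) → glue⇒word desc g
               ; (inj₁ (inj₂ g)) → glue⇒word desc g
               ; (inj₂ g)        → crossing⇒word desc g })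
            (word⇒glue⊎crossing desc (λ ()))
      (card-⊎ (λ { (inj₁ g) → glue-crossing-disjoint desc g ; (inj₂ g) → glue-crossing-disjoint desc g })
        (card-⊎ (glue-disjoint desc 1+n≢0)
          (card-glue V (peaks d (onceEven d) (onceOdd d)) (avoiding up)
            (card-left desc N l onceEven onceOdd (card-once N) d)
            (card-right desc N l avoiding (card-avoiding N))
            (glue-unique desc))
          (card-glue V (peaks d (avoidEven d) (avoidOdd d)) (once up)
            (card-left desc N l avoidEven avoidOdd (card-avoiding N) d)
            (card-right desc N l once (card-once N))
            (glue-unique desc)))
        (card-glue V (peaks (flip d) (avoidEven d) (avoidOdd d)) crossing
          (card-crossLeft desc N l (card-avoiding N) d)
          (card-crossRight desc N l (card-avoiding N))
          (crossing-unique desc))))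

-- Words over an interval

countOcc-≡ : ∀ x w → countOcc x (x ∷ w) ≡ suc (countOcc x w)
countOcc-≡ x w with x ≤ᵇ x | ≤⇒≤ᵇ (≤-refl {x})
... | true | _ = refl

countOcc-≢ : ∀ {a x} w → x ≢ a → countOcc a (x ∷ w) ≡ countOcc a w
countOcc-≢ {a} {x} w x≢a with x ≤ᵇ a | ≤ᵇ⇒≤ x a
... | false | _  = refl
... | true  | x≤a with a ≤ᵇ x | ≤ᵇ⇒≤ a x
...   | false | _   = refl
...   | true  | a≤x = contradiction (≤-antisym (x≤a tt) (a≤x tt)) x≢a

countOcc-absent : ∀ {a} w → a ∉ w → countOcc a w ≡ 0
countOcc-absent []      a∉ = refl
countOcc-absent (x ∷ w) a∉ =
  trans (countOcc-≢ w (λ { refl → a∉ (here refl) })) (countOcc-absent w (a∉ ∘ there))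

countOcc-present : ∀ {a} w → countOcc a w ≢ 0 → a ∈ w
countOcc-present []          c≢0 = contradiction refl c≢0
countOcc-present {a} (x ∷ w) c≢0 with x ≟ a
... | yes refl = here refl
... | no  x≢a  = there (countOcc-present w (c≢0 ∘ trans (countOcc-≢ w x≢a)))

countOcc-↭ : ∀ a {v w} → v ↭ w → countOcc a v ≡ countOcc a w
countOcc-↭ a ↭-rfl        = refl
countOcc-↭ a (prep x p)   = cong (_ +_) (countOcc-↭ a p)
countOcc-↭ a (↭-tr p q)   = trans (countOcc-↭ a p) (countOcc-↭ a q)
countOcc-↭ a {v = x ∷ y ∷ v} {y ∷ x ∷ w} (swap x y p) = begin
  cx + (cy + countOcc a v) ≡⟨ cong (λ t → cx + (cy + t)) (countOcc-↭ a p) ⟩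
  cx + (cy + countOcc a w) ≡⟨ +-assoc cx cy _ ⟨
  cx + cy + countOcc a w   ≡⟨ cong (_+ countOcc a w) (+-comm cx cy) ⟩
  cy + cx + countOcc a w   ≡⟨ +-assoc cy cx _ ⟩
  cy + (cx + countOcc a w) ∎
  where
  cx cy : ℕ
  cx = if (x ≤ᵇ a) ∧ (a ≤ᵇ x) then 1 else 0
  cy = if (y ≤ᵇ a) ∧ (a ≤ᵇ y) then 1 else 0

-- The head of `v` has positive count in `w`; removing it from both words keeps all counts equal.
countOcc⇒↭ : ∀ v w → (∀ a → countOcc a v ≡ countOcc a w) → v ↭ w
countOcc⇒↭ []      []      eq = ↭-refl
countOcc⇒↭ []      (y ∷ w) eq = contradiction (trans (eq y) (countOcc-≡ y w)) 0≢1+n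
countOcc⇒↭ (x ∷ v) w       eq
  with ∈-∃++ (countOcc-present w (λ c≡0 → 0≢1+n (trans (sym c≡0) (trans (sym (eq x)) (countOcc-≡ x v)))))
... | l , r , refl = ↭-trans
  (prep x (countOcc⇒↭ v (l ++ r)
    (λ a → +-cancelˡ-≡ _ _ _ (trans (eq a) (countOcc-↭ a (↭-shift x l r))))))
  (↭-sym (↭-shift x l r))

downTo : ℕ → List ℕ
downTo zero    = []
downTo (suc n) = suc n ∷ downTo n

length-downTo : ∀ n → length (downTo n) ≡ n
length-downTo zero    = refl
length-downTo (suc n) = cong suc (length-downTo n)

InRange : ℕ → ℕ → Set
InRange n x = 1 ≤ x × x ≤ n

downTo-range : ∀ n → All (InRange n) (downTo n)
downTo-range zero    = []
downTo-range (suc n) = (s≤s z≤n , ≤-refl) ∷ All.map (λ (p , q) → p , m≤n⇒m≤1+n q) (downTo-range n)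

downTo-descending : ∀ n → Descending (downTo n)
downTo-descending zero    = []
downTo-descending (suc n) = All.map (s≤s ∘ proj₂) (downTo-range n) ∷ downTo-descending n

countOcc-range : ∀ {n a} w → All (InRange n) w → ¬ InRange n a → countOcc a w ≡ 0
countOcc-range w rs ¬r = countOcc-absent w (¬r ∘ All.lookup rs)

countOcc-downTo : ∀ {n a} → InRange n a → countOcc a (downTo n) ≡ 1
countOcc-downTo {suc n} {a} (1≤a , a≤1+n) with suc n ≟ a
... | yes refl = trans (countOcc-≡ (suc n) (downTo n))
                   (cong suc (countOcc-range (downTo n) (downTo-range n) (λ (_ , q) → 1+n≰n q)))
... | no  n≢a  = trans (countOcc-≢ (downTo n) n≢a)
                   (countOcc-downTo (1≤a , s≤s⁻¹ (≤∧≢⇒< a≤1+n (n≢a ∘ sym))))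
countOcc-downTo {zero} (s≤s _ , ())

-- Enumeration of permutations

allB⁺ : ∀ {A : Set} (p : A → Bool) xs → (∀ {x} → x ∈ xs → T (p x)) → T (allB p xs)
allB⁺ p []       _ = tt
allB⁺ p (x ∷ xs) h = Equivalence.from T-∧ (h (here refl) , allB⁺ p xs (h ∘ there))

allB⁻ : ∀ {A : Set} (p : A → Bool) xs → T (allB p xs) → ∀ {x} → x ∈ xs → T (p x)
allB⁻ p (x ∷ xs) t (here refl) = proj₁ (Equivalence.to (T-∧ {p x}) t)
allB⁻ p (x ∷ xs) t (there i)   = allB⁻ p xs (proj₂ (Equivalence.to (T-∧ {p x}) t)) i

≡1⁺ : ∀ {n} → n ≡ 1 → T ((n ≤ᵇ 1) ∧ (1 ≤ᵇ n))
≡1⁺ refl = tt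

≡1⁻ : ∀ n → T ((n ≤ᵇ 1) ∧ (1 ≤ᵇ n)) → n ≡ 1
≡1⁻ (suc zero) _ = refl

isPerm⁺ : ∀ {n w} → w ↭ downTo n → T (isPermB n w)
isPerm⁺ {n} p = allB⁺ _ (upTo n)
  (λ i → ≡1⁺ (trans (countOcc-↭ _ p) (countOcc-downTo (s≤s z≤n , ∈-upTo⁻ i))))

-- The test inspects the letters 1 to n only; the range hypothesis gives count 0 to all others.
isPerm⁻ : ∀ {n w} → All (InRange n) w → T (isPermB n w) → w ↭ downTo n
isPerm⁻ {n} {w} rs t = countOcc⇒↭ w (downTo n) eq
  where
  eq : ∀ a → countOcc a w ≡ countOcc a (downTo n)
  eq zero = trans (countOcc-range w rs (λ ())) (sym (countOcc-range (downTo n) (downTo-range n) (λ ())))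
  eq (suc i) with suc i ≤? n
  ... | yes i<n = trans (≡1⁻ _ (allB⁻ _ (upTo n) t (∈-upTo⁺ i<n))) (sym (countOcc-downTo (s≤s z≤n , i<n)))
  ... | no  i≮n = trans (countOcc-range w rs (i≮n ∘ proj₂))
                    (sym (countOcc-range (downTo n) (downTo-range n) (i≮n ∘ proj₂)))

words⁺ : ∀ {m} w → All (InRange m) w → w ∈ words m (length w)
words⁺     []          []                = here refl
words⁺ {m} (suc x ∷ w) ((_ , x<m) ∷ rs) =
  ∈-concatMap⁺ _ (Any.map (λ { refl → ∈-map⁺ (λ a → suc a ∷ w) (∈-upTo⁺ x<m) }) (words⁺ w rs))

words⁻ : ∀ {m} k {w} → w ∈ words m k → All (InRange m) w
words⁻     zero    (here refl) = []
words⁻ {m} (suc k) i with find (∈-concatMap⁻ (λ w → map (λ a → suc a ∷ w) (upTo m)) {xs = words m k} i)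
... | v , v∈ , j with ∈-map⁻ (λ a → suc a ∷ v) j
...   | a , a∈ , refl = (s≤s z≤n , ∈-upTo⁻ a∈) ∷ words⁻ k v∈

words-unique : ∀ m k → Unique (words m k)
words-unique m zero    = [] ∷ []
words-unique m (suc k) = Unique.concat⁺
  (All.map⁺ (All.tabulate (λ _ → Unique.map⁺ (suc-injective ∘ ∷-injectiveˡ) (Unique.upTo⁺ m))))
  (AllPairs.map⁺ (AllPairs.map disjoint (words-unique m k)))
  where
  disjoint : ∀ {v w} → v ≢ w → ∀ {u} →
    u ∈ map (λ a → suc a ∷ v) (upTo m) × u ∈ map (λ a → suc a ∷ w) (upTo m) → ⊥
  disjoint v≢w (i , j) with ∈-map⁻ _ i | ∈-map⁻ _ j
  ... | _ , _ , refl | _ , _ , eq = v≢w (∷-injectiveʳ eq)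

card-perms : ∀ n (p : List ℕ → Bool) →
  Card (λ w → w ↭ downTo n × T (p w)) (length (filter (λ w → T? (p w)) (perms n)))
card-perms n p = record
  { elems    = filter (λ w → T? (p w)) (perms n)
  ; unique   = Unique.filter⁺ (λ w → T? (p w)) (Unique.filter⁺ (λ w → T? (isPermB n w)) (words-unique n n))
  ; size     = refl
  ; sound    = λ i → let i₁ , pw   = ∈-filter⁻ (λ w → T? (p w)) {xs = perms n} i
                         i₂ , perm = ∈-filter⁻ (λ w → T? (isPermB n w)) {xs = words n n} i₁
                     in isPerm⁻ (words⁻ n i₂) perm , pw
  ; complete = λ { {w} (perm , pw) →
      ∈-filter⁺ (λ w → T? (p w)) (∈-filter⁺ (λ w → T? (isPermB n w)) (member w perm) (isPerm⁺ perm)) pw }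
  }
  where
  member : ∀ w → w ↭ downTo n → w ∈ words n n
  member w perm = subst (λ k → w ∈ words n k) (trans (↭-length perm) (length-downTo n))
    (words⁺ w (All-resp-↭ (↭-sym perm) (downTo-range n)))

starts : Direction → List ℕ → Bool
starts up   = startsUp
starts down = startsDown

starts⁻ : ∀ d w → T (starts d w) → Alternating d w
starts⁻ d    []          _ = tt
starts⁻ d    (a ∷ [])    _ = tt
starts⁻ up   (a ∷ b ∷ w) t = let s , r = Equivalence.to (T-∧ {a <ᵇ b}) t in <ᵇ⇒< a b s , starts⁻ down (b ∷ w) r
starts⁻ down (a ∷ b ∷ w) t = let s , r = Equivalence.to (T-∧ {b <ᵇ a}) t in <ᵇ⇒< b a s , starts⁻ up (b ∷ w) r

starts⁺ : ∀ d w → Alternating d w → T (starts d w)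
starts⁺ up   []          _       = tt
starts⁺ down []          _       = tt
starts⁺ up   (a ∷ [])    _       = tt
starts⁺ down (a ∷ [])    _       = tt
starts⁺ up   (a ∷ b ∷ w) (s , r) = Equivalence.from T-∧ (<⇒<ᵇ s , starts⁺ down (b ∷ w) r)
starts⁺ down (a ∷ b ∷ w) (s , r) = Equivalence.from T-∧ (<⇒<ᵇ s , starts⁺ up (b ∷ w) r)

count-once : ∀ d cls n → (∀ w → cls n w ≡ starts d w) → count132once cls n ≡ once d n
count-once d cls n cls≡ = card-unique (card-perms n _)
  (card-⇔
    (λ { {w} (p , a , o) → p , Equivalence.from T-∧
           (subst T (sym (cls≡ w)) (starts⁺ d w a) , ≡1⁺ o) })
    (λ { {w} (p , t) → let c , o = Equivalence.to (T-∧ {cls n w}) t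
                       in p , starts⁻ d w (subst T (cls≡ w) c) , ≡1⁻ (occ132 w) o })
    (subst (λ k → Card (Word 1 d (downTo n)) (once d k)) (length-downTo n)
      (card-once _ d (downTo n) ≤-refl (downTo-descending n))))

count-none : ∀ cls n → (∀ w → cls n w ≡ false) → count132once cls n ≡ 0
count-none cls n cls≡ = card-unique (card-perms n _)
  (card-∅ λ {w} (_ , t) → subst T (cls≡ w) (proj₁ (Equivalence.to (T-∧ {cls n w}) t)))

-- Closed forms

open import Data.Integer using (ℤ; +_; _-_)
import Data.Integer as ℤ
import Data.Integer.Properties as ℤ

twice : ℕ → ℕ
twice zero    = zero
twice (suc n) = suc (suc (twice n))

data EvenOdd : ℕ → Set where
  even : ∀ m → EvenOdd (twice m)
  odd  : ∀ m → EvenOdd (suc (twice m))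

evenOdd : ∀ n → EvenOdd n
evenOdd zero    = even zero
evenOdd (suc n) with evenOdd n
... | even m = odd m
... | odd m  = even (suc m)

twice≡+ : ∀ m → twice m ≡ m + m
twice≡+ zero    = refl
twice≡+ (suc m) = cong suc (trans (cong suc (twice≡+ m)) (sym (+-suc m m)))

oddB-even : ∀ m → oddB (twice m) ≡ false
oddB-even zero    = refl
oddB-even (suc m) = oddB-even m

oddB-odd : ∀ m → oddB (suc (twice m)) ≡ true
oddB-odd zero    = refl
oddB-odd (suc m) = oddB-odd m

interleave-even : ∀ f g m → interleave f g (twice m) ≡ f m
interleave-even f g zero    = refl
interleave-even f g (suc m) = interleave-even (tail f) (tail g) m

interleave-odd : ∀ f g m → interleave f g (suc (twice m)) ≡ g m
interleave-odd f g m = interleave-even g (tail f) m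

halving : (h : ℕ → ℕ) → h 0 ≡ 0 → (∀ k → h (2 + k) ≡ suc (h k)) → ∀ k → h (twice k) ≡ k
halving h h0 hss zero    = h0
halving h h0 hss (suc k) = trans (hss _) (cong suc (halving h h0 hss k))

-- The halving function local to halfBinom cannot be named; the placeholder is solved to it by unification.
mutual
  half : ℕ → ℕ → ℕ → ℕ
  half = _

  halfBinom-half : ∀ m s → oddB s ≡ false → halfBinom (+ m) (+ (2 + s)) ≡ m C suc (half m (2 + s) s)
  -- With `suc (suc s)` abstracted to a variable, `half` is applied to three distinct variables, so
  -- the unification problem has a unique solution.
  halfBinom-half m s e with oddB s | e | suc (suc s)
  ... | _ | refl | t = refl

halfBinom-even : ∀ m k → halfBinom (+ m) (+ (twice k)) ≡ m C k
halfBinom-even m zero    = refl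
halfBinom-even m (suc k) = trans (halfBinom-half m (twice k) (oddB-even k))
  (cong (λ h → m C suc h) (halving (half m (2 + twice k)) refl (λ _ → refl) k))

halfBinom-odd : ∀ a k → halfBinom a (+ suc (twice k)) ≡ 0
halfBinom-odd a k rewrite oddB-odd k = refl

halfBinom-ladder : ∀ j k → halfBinom (+ (j + twice k)) (+ (twice k)) ≡ binomialLadder j k
halfBinom-ladder j k = trans (halfBinom-even (j + twice k) k) (cong (λ t → (j + t) C k) (twice≡+ k))

count-upDown : ∀ n → count132once upDown n ≡ halfBinom (+ n - + 1) (+ n - + 3)
count-upDown n with evenOdd n
-- For n = 0, 1, 2 the integer n - 3 is negative and the right side reduces to 0.
... | even zero          = refl
... | even (suc zero)    = count-none upDown 2 (λ _ → refl)
... | even (suc (suc m)) = trans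
  (count-none upDown (twice (2 + m)) (λ w → cong (_∧ startsUp w) (oddB-even m)))
  (sym (halfBinom-odd (+ (3 + twice m)) m))
... | odd zero           = count-none upDown 1 (λ _ → refl)
... | odd (suc m)        = begin
  count132once upDown (3 + twice m)
    ≡⟨ count-once up upDown (3 + twice m) (λ w → cong (_∧ startsUp w) (oddB-odd m)) ⟩
  once up (3 + twice m)
    ≡⟨ interleave-odd (onceEven up) (onceOdd up) (suc m) ⟩
  binomialLadder 2 m
    ≡⟨ halfBinom-ladder 2 m ⟨
  halfBinom (+ (2 + twice m)) (+ (twice m)) ∎

count-even : ∀ d cls →
  (∀ m w → cls (2 + twice m) w ≡ starts d w) → (∀ m w → cls (suc (twice m)) w ≡ false) →
  (∀ w → cls 0 w ≡ false) →
  ∀ n → count132once cls n ≡ 2 * halfBinom (+ n - + 1) (+ n - + 4)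
count-even d cls cls-even cls-odd cls-0 n with evenOdd n
... | even zero          = count-none cls 0 cls-0
-- The class is not empty for n = 2, but the coefficient of `once` vanishes there, as does the right
-- side since n - 4 is negative.
... | even (suc zero)    = count-once d cls 2 (cls-even 0)
... | even (suc (suc m)) = begin
  count132once cls (4 + twice m)
    ≡⟨ count-once d cls (4 + twice m) (cls-even (suc m)) ⟩
  once d (4 + twice m)
    ≡⟨ interleave-even (onceEven d) (onceOdd d) (2 + m) ⟩
  2 * binomialLadder 3 m
    ≡⟨ cong (2 *_) (halfBinom-ladder 3 m) ⟨
  2 * halfBinom (+ (3 + twice m)) (+ (twice m)) ∎
... | odd zero          = count-none cls 1 (cls-odd 0)
... | odd (suc zero)    = count-none cls 3 (cls-odd 1)
... | odd (suc (suc m)) = trans (count-none cls (5 + twice m) (cls-odd (2 + m)))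
  (cong (2 *_) (sym (halfBinom-odd (+ (4 + twice m)) m)))

count-upUp : ∀ n → count132once upUp n ≡ 2 * halfBinom (+ n - + 1) (+ n - + 4)
count-upUp = count-even up upUp
  (λ m w → cong (λ b → notB b ∧ startsUp w) (oddB-even m))
  (λ { zero w → refl ; (suc m) w → cong (λ b → notB b ∧ startsUp w) (oddB-odd m) })
  (λ _ → refl)

count-downDown : ∀ n → count132once downDown n ≡ 2 * halfBinom (+ n - + 1) (+ n - + 4)
count-downDown = count-even down downDown
  (λ m w → cong (λ b → notB b ∧ startsDown w) (oddB-even m))
  (λ { zero w → refl ; (suc m) w → cong (λ b → notB b ∧ startsDown w) (oddB-odd m) })
  (λ _ → refl)

-- Both sides are expanded in terms of p = F₁(k+1), b = F₃(k), a = F₄(k), where F = binomialLadder.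
onceOdd-closed : ∀ m →
  2 * onceOdd down (suc m) + 10 * binomialLadder 0 (2 + m) ≡ 3 * binomialLadder 0 (3 + m)
onceOdd-closed zero    = refl
onceOdd-closed (suc k) = begin
  2 * (2 * (2 * a) + t) + 10 * F 0 (3 + k)
    ≡⟨ cong (λ x → 2 * (2 * (2 * a) + t) + 10 * x) F₀[3+k] ⟩
  2 * (2 * (2 * a) + t) + 10 * (6 * p + 2 * b)
    ≡⟨ solve 4 (λ a b p t → con 2 :* (con 2 :* (con 2 :* a) :+ t) :+ con 10 :* (con 6 :* p :+ con 2 :* b)
                         := con 60 :* p :+ con 20 :* b :+ con 6 :* a :+ con 2 :* (t :+ a)) refl a b p t ⟩
  60 * p + 20 * b + 6 * a + 2 * (t + a)
    -- The relation C⁴ + BC⁴ = 2BC³ removes the term without the factor B.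
    ≡⟨ cong (λ x → 60 * p + 20 * b + 6 * a + 2 * x) (catalanPower+binomialLadder 3 k) ⟩
  60 * p + 20 * b + 6 * a + 2 * (2 * b)
    ≡⟨ solve 3 (λ a b p → con 60 :* p :+ con 20 :* b :+ con 6 :* a :+ con 2 :* (con 2 :* b)
                       := con 3 :* (con 2 :* ((con 6 :* p :+ con 2 :* b) :+ (((con 3 :* p :+ b) :+ ((p :+ b) :+ a))))))
         refl a b p ⟩
  3 * (2 * ((6 * p + 2 * b) + ((3 * p + b) + ((p + b) + a))))
    ≡⟨ cong (3 *_) F₀[4+k] ⟨
  3 * F 0 (4 + k) ∎
  where
  open +-*-Solver
  F = binomialLadder
  a = F 4 k
  b = F 3 k
  p = F 1 (suc k)
  t = catalanPower 4 k
  F₂[1+k] : F 2 (1 + k) ≡ p + b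
  F₂[1+k] = binomialLadder-ladder 1 (suc k)
  F₁[2+k] : F 1 (2 + k) ≡ 3 * p + b
  F₁[2+k] = begin
    F 1 (2 + k)               ≡⟨ binomialLadder-ladder 0 (2 + k) ⟩
    F 0 (2 + k) + F 2 (1 + k) ≡⟨ cong₂ _+_ (binomialLadder-base (2 + k)) F₂[1+k] ⟩
    2 * p + (p + b)           ≡⟨ solve 2 (λ p b → con 2 :* p :+ (p :+ b) := con 3 :* p :+ b) refl p b ⟩
    3 * p + b                 ∎
  F₀[3+k] : F 0 (3 + k) ≡ 6 * p + 2 * b
  F₀[3+k] = begin
    F 0 (3 + k)     ≡⟨ binomialLadder-base (3 + k) ⟩
    2 * F 1 (2 + k) ≡⟨ cong (2 *_) F₁[2+k] ⟩
    2 * (3 * p + b) ≡⟨ solve 2 (λ p b → con 2 :* (con 3 :* p :+ b) := con 6 :* p :+ con 2 :* b) refl p b ⟩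
    6 * p + 2 * b   ∎
  F₃[1+k] : F 3 (1 + k) ≡ (p + b) + a
  F₃[1+k] = trans (binomialLadder-ladder 2 (suc k)) (cong (_+ a) F₂[1+k])
  F₂[2+k] : F 2 (2 + k) ≡ (3 * p + b) + ((p + b) + a)
  F₂[2+k] = trans (binomialLadder-ladder 1 (2 + k)) (cong₂ _+_ F₁[2+k] F₃[1+k])
  F₀[4+k] : F 0 (4 + k) ≡ 2 * ((6 * p + 2 * b) + ((3 * p + b) + ((p + b) + a)))
  F₀[4+k] = trans (binomialLadder-base (4 + k))
    (cong (2 *_) (trans (binomialLadder-ladder 0 (3 + k)) (cong₂ _+_ F₀[3+k] F₂[2+k])))

pos-difference : ∀ i x j y k u → i * x + j * y ≡ k * u →
  + i ℤ.* + x ≡ + k ℤ.* + u - + j ℤ.* + y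
pos-difference i x j y k u eq = begin
  + i ℤ.* + x                                     ≡⟨ ℤ.+-identityʳ (+ i ℤ.* + x) ⟨
  + i ℤ.* + x ℤ.+ + 0                             ≡⟨ cong (λ v → + i ℤ.* + x ℤ.+ v) (ℤ.+-inverseʳ (+ j ℤ.* + y)) ⟨
  + i ℤ.* + x ℤ.+ (+ j ℤ.* + y - + j ℤ.* + y)     ≡⟨ ℤ.+-assoc (+ i ℤ.* + x) (+ j ℤ.* + y) _ ⟨
  + i ℤ.* + x ℤ.+ + j ℤ.* + y - + j ℤ.* + y       ≡⟨ cong (_- + j ℤ.* + y) sum ⟩
  + k ℤ.* + u - + j ℤ.* + y                       ∎
  where
  sum : + i ℤ.* + x ℤ.+ + j ℤ.* + y ≡ + k ℤ.* + u
  sum = begin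
    + i ℤ.* + x ℤ.+ + j ℤ.* + y ≡⟨ cong₂ ℤ._+_ (ℤ.pos-* i x) (ℤ.pos-* j y) ⟨
    + (i * x) ℤ.+ + (j * y)     ≡⟨⟩
    + (i * x + j * y)           ≡⟨ cong +_ eq ⟩
    + (k * u)                   ≡⟨ ℤ.pos-* k u ⟩
    + k ℤ.* + u                 ∎

-- Doubling clears the factor 3/2. The identity is first proved for natural numbers, with the
-- subtracted term moved to the left.
count-downUp : ∀ n → 2 ≤ n →
  + 2 ℤ.* + count132once downUp n ≡
  + 3 ℤ.* + halfBinom (+ (n + 3)) (+ (n + 3)) - + 10 ℤ.* + halfBinom (+ (n + 1)) (+ (n + 1))
count-downUp n 2≤n = pos-difference
  2 (count132once downUp n) 10 (halfBinom (+ (n + 1)) (+ (n + 1))) 3 (halfBinom (+ (n + 3)) (+ (n + 3)))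
  (subst₂ (λ s t → 2 * count132once downUp n + 10 * halfBinom (+ t) (+ t) ≡ 3 * halfBinom (+ s) (+ s))
    (+-comm 3 n) (+-comm 1 n) (go n 2≤n (evenOdd n)))
  where
  go : ∀ n → 2 ≤ n → EvenOdd n →
    2 * count132once downUp n + 10 * halfBinom (+ suc n) (+ suc n) ≡ 3 * halfBinom (+ (3 + n)) (+ (3 + n))
  go _ _ (even zero)    = refl
  go _ _ (even (suc m)) = begin
    2 * count132once downUp (2 + twice m) + 10 * halfBinom (+ (3 + twice m)) (+ (3 + twice m))
      ≡⟨ cong₂ (λ c h → 2 * c + 10 * h)
           (count-none downUp (2 + twice m) (λ w → cong (_∧ startsDown w) (oddB-even m)))
           (halfBinom-odd (+ (3 + twice m)) (suc m)) ⟩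
    0
      ≡⟨ cong (3 *_) (halfBinom-odd (+ (5 + twice m)) (2 + m)) ⟨
    3 * halfBinom (+ (5 + twice m)) (+ (5 + twice m)) ∎
  -- At n = 1 the formula would give 9 - 10 = -1, so the bound on n is essential here.
  go _ (s≤s ()) (odd zero)
  go _ _ (odd (suc m)) = begin
    2 * count132once downUp (3 + twice m) + 10 * halfBinom (+ (4 + twice m)) (+ (4 + twice m))
      ≡⟨ cong₂ (λ c h → 2 * c + 10 * h)
           (trans (count-once down downUp (3 + twice m) (λ w → cong (_∧ startsDown w) (oddB-odd m)))
                  (interleave-odd (onceEven down) (onceOdd down) (suc m)))
           (halfBinom-ladder 0 (2 + m)) ⟩
    2 * onceOdd down (suc m) + 10 * binomialLadder 0 (2 + m)
      ≡⟨ onceOdd-closed m ⟩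
    3 * binomialLadder 0 (3 + m)
      ≡⟨ cong (3 *_) (halfBinom-ladder 0 (3 + m)) ⟨
    3 * halfBinom (+ (6 + twice m)) (+ (6 + twice m)) ∎

theorem4p2 : ((n : ℕ) → count132once upDown n ≡ halfBinom (+ n - + 1) (+ n - + 3))
    × ((n : ℕ) → count132once upUp n ≡ 2 * halfBinom (+ n - + 1) (+ n - + 4))
    × ((n : ℕ) → count132once downDown n ≡ 2 * halfBinom (+ n - + 1) (+ n - + 4))
    × ((n : ℕ) → 2 ≤ n →
    (+ 2) Data.Integer.* (+ count132once downUp n)
    ≡ (+ 3) Data.Integer.* (+ halfBinom (+ (n Data.Nat.+ 3)) (+ (n Data.Nat.+ 3)))
    - (+ 10) Data.Integer.* (+ halfBinom (+ (n Data.Nat.+ 1)) (+ (n Data.Nat.+ 1))))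
theorem4p2 = count-upDown , count-upUp , count-downDown , count-downUp
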